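{- Let $q$ be a power of an odd prime $p$ and let $\chi$ be a non-trivial multiplicative character of $\mathbb{F}_q$. Then for any subsets $A,B \subseteq \mathbb{F}_q$, $$\bigg|\sum_{a\in A,\, b\in B}\chi(a+b)\bigg| \leq \sqrt{q|A||B|}\Big(1-\frac{|A|}{q}\Big)^{1/2}\Big(1-\frac{|B|}{q}\Big)^{1/2}.$$
   Context: Multiplicative characters of $\mathbb{F}_q$ are homomorphisms $\mathbb{F}_q^*\to\mathbb{C}^*$, extended by $\chi(0)=0$. -}

module Defs where

open import Algebra.Bundles using (CommutativeRing; RawMonoid)
import Algebra.Definitions.RawMonoid as RawMonoidDefinitions
open import Data.Bool.Base using (if_then_else_)
open import Data.Fin.Base using (Fin)
open import Data.Fin.Subset using (Subset; ∣_∣)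
open import Data.Integer.Base as ℤ using (+_; -[1+_])
import Data.Integer.Properties as ℤ
open import Data.Nat.Base as ℕ using (ℕ; zero; suc)
import Data.Nat.DivMod as ℕ
import Data.Nat.Properties as ℕ
open import Data.Product.Base using (∃-syntax; _×_; _,_; proj₁; proj₂)
open import Data.Rational.Base as ℚ using (ℚ; mkℚ; 0ℚ; 1ℚ; ½; _/_; ↥_; ↧ₙ_; toℚᵘ; *<*; *≤*)
import Data.Rational.Properties as ℚ
open import Data.Rational.Solver using (module +-*-Solver)
open import Data.Rational.Unnormalised.Base as ℚᵘ using (mkℚᵘ)
import Data.Rational.Unnormalised.Properties as ℚᵘ
open import Data.Sum.Base using (inj₁; inj₂)
open import Data.Vec.Base using (lookup)
open import Function.Bundles using (Inverse)
open import Level using (Level; 0ℓ; _⊔_) renaming (suc to lsuc)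
open import Relation.Binary.PropositionalEquality using (_≡_; refl; sym; trans; cong; cong₂; subst; subst₂) renaming (setoid to ≡-setoid)
open import Relation.Nullary.Decidable.Core using (yes; no)
open import Relation.Nullary.Negation.Core using (¬_; contradiction)

Cauchy : (ℕ → ℚ) → Set
Cauchy x = ∀ ε → 0ℚ ℚ.< ε → ∃[ N ] (∀ m n → N ℕ.≤ m → N ℕ.≤ n → ℚ.∣ x m ℚ.- x n ∣ ℚ.≤ ε)

-- Two sequences denote the same real when they are related by _≈ᴿ_ below.
record ℝ : Set where
  constructor mkℝ
  field
    seq    : ℕ → ℚ
    cauchy : Cauchy seq

open ℝ public

infix 4 _≈ᴿ_ _≤ᴿ_

_≈ᴿ_ : ℝ → ℝ → Set
x ≈ᴿ y = ∀ ε → 0ℚ ℚ.< ε → ∃[ N ] (∀ n → N ℕ.≤ n → ℚ.∣ seq x n ℚ.- seq y n ∣ ℚ.≤ ε)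

_≤ᴿ_ : ℝ → ℝ → Set
x ≤ᴿ y = ∀ ε → 0ℚ ℚ.< ε → ∃[ N ] (∀ n → N ℕ.≤ n → seq x n ℚ.≤ seq y n ℚ.+ ε)

private
  open +-*-Solver using (solve; _:=_; _:+_; _:*_; _:-_; :-_)

  half-pos : ∀ {ε} → 0ℚ ℚ.< ε → 0ℚ ℚ.< ½ ℚ.* ε
  half-pos {ε} 0<ε = subst (ℚ._< ½ ℚ.* ε) (ℚ.*-zeroʳ ½) (ℚ.*-monoʳ-<-pos ½ 0<ε)

  halves : ∀ ε → ½ ℚ.* ε ℚ.+ ½ ℚ.* ε ≡ ε
  halves ε = trans (sym (ℚ.*-distribʳ-+ ε ½ ½)) (ℚ.*-identityˡ ε)

  p≤∣p∣ : ∀ p → p ℚ.≤ ℚ.∣ p ∣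
  p≤∣p∣ p with ℚ.≤-total 0ℚ p
  ... | inj₁ 0≤p = ℚ.≤-reflexive (sym (ℚ.0≤p⇒∣p∣≡p 0≤p))
  ... | inj₂ p≤0 = ℚ.≤-trans p≤0 (ℚ.0≤∣p∣ p)

  p≤q+∣p-q∣ : ∀ p q → p ℚ.≤ q ℚ.+ ℚ.∣ p ℚ.- q ∣
  p≤q+∣p-q∣ p q = subst (ℚ._≤ q ℚ.+ ℚ.∣ p ℚ.- q ∣)
    (solve 2 (λ p q → q :+ (p :- q) := p) refl p q)
    (ℚ.+-monoʳ-≤ q (p≤∣p∣ (p ℚ.- q)))

  p≤q+r⇒p-q≤r : ∀ p q r → p ℚ.≤ q ℚ.+ r → p ℚ.- q ℚ.≤ r
  p≤q+r⇒p-q≤r p q r h = subst (p ℚ.- q ℚ.≤_)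
    (solve 2 (λ q r → (q :+ r) :- q := r) refl q r)
    (ℚ.+-monoˡ-≤ (ℚ.- q) h)

  ∣p-q∣≤r : ∀ p q r → p ℚ.≤ q ℚ.+ r → q ℚ.≤ p ℚ.+ r → ℚ.∣ p ℚ.- q ∣ ℚ.≤ r
  ∣p-q∣≤r p q r h₁ h₂ with ℚ.∣p∣≡p∨∣p∣≡-p (p ℚ.- q)
  ... | inj₁ eq = subst (ℚ._≤ r) (sym eq) (p≤q+r⇒p-q≤r p q r h₁)
  ... | inj₂ eq = subst (ℚ._≤ r)
    (sym (trans eq (solve 2 (λ p q → :- (p :- q) := q :- p) refl p q)))
    (p≤q+r⇒p-q≤r q p r h₂)

  *-mono-≤ : ∀ {p q r s} → 0ℚ ℚ.≤ r → 0ℚ ℚ.≤ q → p ℚ.≤ q → r ℚ.≤ s → p ℚ.* r ℚ.≤ q ℚ.* s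
  *-mono-≤ {p} {q} {r} {s} 0≤r 0≤q p≤q r≤s = ℚ.≤-trans
    (ℚ.*-monoʳ-≤-nonNeg r {{ℚ.nonNegative 0≤r}} p≤q)
    (ℚ.*-monoˡ-≤-nonNeg q {{ℚ.nonNegative 0≤q}} r≤s)

fromℚ : ℚ → ℝ
fromℚ p = mkℝ (λ _ → p) λ ε 0<ε → 0 , λ _ _ _ _ →
  subst (λ d → ℚ.∣ d ∣ ℚ.≤ ε) (sym (ℚ.+-inverseʳ p)) (ℚ.<⇒≤ 0<ε)

fromℕ : ℕ → ℝ
fromℕ n = fromℚ (+ n / 1)

0ᴿ 1ᴿ : ℝ
0ᴿ = fromℚ 0ℚ
1ᴿ = fromℚ 1ℚ

infix  8 -ᴿ_
infixl 7 _*ᴿ_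
infixl 6 _+ᴿ_ _-ᴿ_

private
  +-cauchy : ∀ {x y} → Cauchy x → Cauchy y → Cauchy (λ n → x n ℚ.+ y n)
  +-cauchy {x} {y} cx cy ε 0<ε =
    proj₁ X ℕ.⊔ proj₁ Y , λ m n N≤m N≤n → begin
      ℚ.∣ (x m ℚ.+ y m) ℚ.- (x n ℚ.+ y n) ∣
        ≡⟨ cong ℚ.∣_∣ (solve 4 (λ a b c d → (a :+ b) :- (c :+ d) := (a :- c) :+ (b :- d))
             refl (x m) (y m) (x n) (y n)) ⟩
      ℚ.∣ (x m ℚ.- x n) ℚ.+ (y m ℚ.- y n) ∣
        ≤⟨ ℚ.∣p+q∣≤∣p∣+∣q∣ (x m ℚ.- x n) (y m ℚ.- y n) ⟩
      ℚ.∣ x m ℚ.- x n ∣ ℚ.+ ℚ.∣ y m ℚ.- y n ∣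
        ≤⟨ ℚ.+-mono-≤
             (proj₂ X m n (ℕ.≤-trans X≤ N≤m) (ℕ.≤-trans X≤ N≤n))
             (proj₂ Y m n (ℕ.≤-trans Y≤ N≤m) (ℕ.≤-trans Y≤ N≤n)) ⟩
      ½ ℚ.* ε ℚ.+ ½ ℚ.* ε
        ≡⟨ halves ε ⟩
      ε ∎
    where
    open ℚ.≤-Reasoning
    X = cx (½ ℚ.* ε) (half-pos 0<ε)
    Y = cy (½ ℚ.* ε) (half-pos 0<ε)
    X≤ = ℕ.m≤m⊔n (proj₁ X) (proj₁ Y)
    Y≤ = ℕ.m≤n⊔m (proj₁ X) (proj₁ Y)

  neg-cauchy : ∀ {x} → Cauchy x → Cauchy (λ n → ℚ.- x n)
  neg-cauchy {x} cx ε 0<ε with cx ε 0<ε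
  ... | N , h = N , λ m n N≤m N≤n → subst (ℚ._≤ ε)
    (trans (sym (ℚ.∣-p∣≡∣p∣ (x m ℚ.- x n)))
      (cong ℚ.∣_∣ (solve 2 (λ a b → :- (a :- b) := :- a :- (:- b)) refl (x m) (x n))))
    (h m n N≤m N≤n)

  eventually-bounded : ∀ {x} → Cauchy x →
    ∃[ M ] (0ℚ ℚ.< M × ∃[ N ] (∀ n → N ℕ.≤ n → ℚ.∣ x n ∣ ℚ.≤ M))
  eventually-bounded {x} cx with cx 1ℚ (*<* (ℤ.+<+ (ℕ.s≤s ℕ.z≤n)))
  ... | N , h = M , 0<M , N , λ n N≤n → begin
      ℚ.∣ x n ∣
        ≡⟨ cong ℚ.∣_∣ (solve 2 (λ a b → a := b :+ (a :- b)) refl (x n) (x N)) ⟩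
      ℚ.∣ x N ℚ.+ (x n ℚ.- x N) ∣
        ≤⟨ ℚ.∣p+q∣≤∣p∣+∣q∣ (x N) (x n ℚ.- x N) ⟩
      ℚ.∣ x N ∣ ℚ.+ ℚ.∣ x n ℚ.- x N ∣
        ≤⟨ ℚ.+-monoʳ-≤ ℚ.∣ x N ∣ (h n N N≤n ℕ.≤-refl) ⟩
      M ∎
    where
    open ℚ.≤-Reasoning
    M = ℚ.∣ x N ∣ ℚ.+ 1ℚ
    0<M : 0ℚ ℚ.< M
    0<M = ℚ.+-mono-≤-< {0ℚ} {ℚ.∣ x N ∣} {0ℚ} {1ℚ} (ℚ.0≤∣p∣ (x N)) (*<* (ℤ.+<+ (ℕ.s≤s ℕ.z≤n)))

  shrink : ∀ M η → 0ℚ ℚ.< M → 0ℚ ℚ.< η → ∃[ δ ] (0ℚ ℚ.< δ × M ℚ.* δ ≡ η)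
  shrink M η 0<M 0<η = 1/M ℚ.* η , 0<δ , Mδ≡η
    where
    1/M : ℚ
    1/M = ℚ.1/_ M {{ℚ.pos⇒nonZero M {{ℚ.positive 0<M}}}}
    0<δ : 0ℚ ℚ.< 1/M ℚ.* η
    0<δ = subst (ℚ._< 1/M ℚ.* η) (ℚ.*-zeroʳ 1/M)
      (ℚ.*-monoʳ-<-pos 1/M {{ℚ.1/pos⇒pos M {{ℚ.positive 0<M}}}} 0<η)
    Mδ≡η : M ℚ.* (1/M ℚ.* η) ≡ η
    Mδ≡η = trans (sym (ℚ.*-assoc M 1/M η))
      (trans (cong (ℚ._* η) (ℚ.*-inverseʳ M {{ℚ.pos⇒nonZero M {{ℚ.positive 0<M}}}})) (ℚ.*-identityˡ η))

  product-close : ∀ a b c d K L δ₁ δ₂ → 0ℚ ℚ.≤ K → 0ℚ ℚ.≤ L →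
    ℚ.∣ a ∣ ℚ.≤ K → ℚ.∣ d ∣ ℚ.≤ L → ℚ.∣ b ℚ.- d ∣ ℚ.≤ δ₁ → ℚ.∣ a ℚ.- c ∣ ℚ.≤ δ₂ →
    ℚ.∣ a ℚ.* b ℚ.- c ℚ.* d ∣ ℚ.≤ K ℚ.* δ₁ ℚ.+ L ℚ.* δ₂
  product-close a b c d K L δ₁ δ₂ 0≤K 0≤L a≤K d≤L b-d≤δ₁ a-c≤δ₂ = begin
    ℚ.∣ a ℚ.* b ℚ.- c ℚ.* d ∣
      ≡⟨ cong ℚ.∣_∣ (solve 4 (λ a b c d → a :* b :- c :* d := a :* (b :- d) :+ d :* (a :- c)) refl a b c d) ⟩
    ℚ.∣ a ℚ.* (b ℚ.- d) ℚ.+ d ℚ.* (a ℚ.- c) ∣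
      ≤⟨ ℚ.∣p+q∣≤∣p∣+∣q∣ (a ℚ.* (b ℚ.- d)) (d ℚ.* (a ℚ.- c)) ⟩
    ℚ.∣ a ℚ.* (b ℚ.- d) ∣ ℚ.+ ℚ.∣ d ℚ.* (a ℚ.- c) ∣
      ≡⟨ cong₂ ℚ._+_ (ℚ.∣p*q∣≡∣p∣*∣q∣ a (b ℚ.- d)) (ℚ.∣p*q∣≡∣p∣*∣q∣ d (a ℚ.- c)) ⟩
    ℚ.∣ a ∣ ℚ.* ℚ.∣ b ℚ.- d ∣ ℚ.+ ℚ.∣ d ∣ ℚ.* ℚ.∣ a ℚ.- c ∣
      ≤⟨ ℚ.+-mono-≤ (*-mono-≤ (ℚ.0≤∣p∣ (b ℚ.- d)) 0≤K a≤K b-d≤δ₁)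
                    (*-mono-≤ (ℚ.0≤∣p∣ (a ℚ.- c)) 0≤L d≤L a-c≤δ₂) ⟩
    K ℚ.* δ₁ ℚ.+ L ℚ.* δ₂ ∎
    where open ℚ.≤-Reasoning

  *-cauchy : ∀ {x y} → Cauchy x → Cauchy y → Cauchy (λ n → x n ℚ.* y n)
  *-cauchy {x} {y} cx cy ε 0<ε =
    let K , 0<K , N₁ , x≤K = eventually-bounded {x} cx
        L , 0<L , N₂ , y≤L = eventually-bounded {y} cy
        δ₁ , 0<δ₁ , Kδ₁ = shrink K (½ ℚ.* ε) 0<K (half-pos 0<ε)
        δ₂ , 0<δ₂ , Lδ₂ = shrink L (½ ℚ.* ε) 0<L (half-pos 0<ε)
        N₃ , y-close = cy δ₁ 0<δ₁
        N₄ , x-close = cx δ₂ 0<δ₂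
        N₁≤ = ℕ.≤-trans (ℕ.m≤m⊔n N₁ N₂) (ℕ.m≤m⊔n (N₁ ℕ.⊔ N₂) (N₃ ℕ.⊔ N₄))
        N₂≤ = ℕ.≤-trans (ℕ.m≤n⊔m N₁ N₂) (ℕ.m≤m⊔n (N₁ ℕ.⊔ N₂) (N₃ ℕ.⊔ N₄))
        N₃≤ = ℕ.≤-trans (ℕ.m≤m⊔n N₃ N₄) (ℕ.m≤n⊔m (N₁ ℕ.⊔ N₂) (N₃ ℕ.⊔ N₄))
        N₄≤ = ℕ.≤-trans (ℕ.m≤n⊔m N₃ N₄) (ℕ.m≤n⊔m (N₁ ℕ.⊔ N₂) (N₃ ℕ.⊔ N₄))
    in (N₁ ℕ.⊔ N₂) ℕ.⊔ (N₃ ℕ.⊔ N₄) , λ m n N≤m N≤n →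
      subst (ℚ.∣ x m ℚ.* y m ℚ.- x n ℚ.* y n ∣ ℚ.≤_)
        (trans (cong₂ ℚ._+_ Kδ₁ Lδ₂) (halves ε))
        (product-close (x m) (y m) (x n) (y n) K L δ₁ δ₂ (ℚ.<⇒≤ 0<K) (ℚ.<⇒≤ 0<L)
          (x≤K m (ℕ.≤-trans N₁≤ N≤m)) (y≤L n (ℕ.≤-trans N₂≤ N≤n))
          (y-close m n (ℕ.≤-trans N₃≤ N≤m) (ℕ.≤-trans N₃≤ N≤n))
          (x-close m n (ℕ.≤-trans N₄≤ N≤m) (ℕ.≤-trans N₄≤ N≤n)))

_+ᴿ_ : ℝ → ℝ → ℝ
x +ᴿ y = mkℝ (λ n → seq x n ℚ.+ seq y n) (+-cauchy {seq x} {seq y} (cauchy x) (cauchy y))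

-ᴿ_ : ℝ → ℝ
-ᴿ x = mkℝ (λ n → ℚ.- seq x n) (neg-cauchy {seq x} (cauchy x))

_-ᴿ_ : ℝ → ℝ → ℝ
x -ᴿ y = x +ᴿ (-ᴿ y)

_*ᴿ_ : ℝ → ℝ → ℝ
x *ᴿ y = mkℝ (λ n → seq x n ℚ.* seq y n) (*-cauchy {seq x} {seq y} (cauchy x) (cauchy y))

-- ⌊√n⌋
isqrt : ℕ → ℕ
isqrt zero    = 0
isqrt (suc n) with isqrt n
... | r with suc r ℕ.* suc r ℕ.≤? suc n
...   | yes _ = suc r
...   | no  _ = r

-- ⌊N√a⌋ for a ≥ 0, computed as the integer square root of ⌊N²a⌋.
root-numerator : ℕ → ℚ → ℕ
root-numerator N a = isqrt ((ℤ.∣ ↥ a ∣ ℕ.* (N ℕ.* N)) ℕ./ ↧ₙ a)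

-- The largest multiple of 1/(n+1) not exceeding √(max 0 a).
root-approx : ℕ → ℚ → ℚ
root-approx n a = + root-numerator (suc n) (0ℚ ℚ.⊔ a) / suc n

isqrt-lower : ∀ n → isqrt n ℕ.* isqrt n ℕ.≤ n
isqrt-lower zero = ℕ.z≤n
isqrt-lower (suc n) with isqrt n | isqrt-lower n
... | r | ih with suc r ℕ.* suc r ℕ.≤? suc n
...   | yes h = h
...   | no  _ = ℕ.m≤n⇒m≤1+n ih

isqrt-upper : ∀ n → n ℕ.< suc (isqrt n) ℕ.* suc (isqrt n)
isqrt-upper zero = ℕ.s≤s ℕ.z≤n
isqrt-upper (suc n) with isqrt n | isqrt-upper n
... | r | ih with suc r ℕ.* suc r ℕ.≤? suc n
...   | yes _ = ℕ.≤-<-trans ih (ℕ.*-mono-< (ℕ.n<1+n (suc r)) (ℕ.n<1+n (suc r)))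
...   | no  h = ℕ.≰⇒> h

private
  toℚᵘ-sq : ∀ k n → toℚᵘ ((+ k / suc n) ℚ.* (+ k / suc n)) ℚᵘ.≃ mkℚᵘ (+ k) n ℚᵘ.* mkℚᵘ (+ k) n
  toℚᵘ-sq k n = ℚᵘ.≃-trans (ℚ.toℚᵘ-homo-* (+ k / suc n) (+ k / suc n))
    (ℚᵘ.*-cong (ℚ.toℚᵘ-fromℚᵘ (mkℚᵘ (+ k) n)) (ℚ.toℚᵘ-fromℚᵘ (mkℚᵘ (+ k) n)))

  sq-lower : ∀ k n a → 0ℚ ℚ.≤ a → k ℕ.* k ℕ.* ↧ₙ a ℕ.≤ ℤ.∣ ↥ a ∣ ℕ.* (suc n ℕ.* suc n) →
    (+ k / suc n) ℚ.* (+ k / suc n) ℚ.≤ a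
  sq-lower k n (mkℚ (+ p) d _) _ h = ℚ.toℚᵘ-cancel-≤
    (ℚᵘ.≤-respˡ-≃ (ℚᵘ.≃-sym (toℚᵘ-sq k n)) (ℚᵘ.*≤* (subst₂ ℤ._≤_
      (trans (ℤ.pos-* (k ℕ.* k) (suc d)) (cong (ℤ._* + suc d) (ℤ.pos-* k k)))
      (ℤ.pos-* p (suc n ℕ.* suc n))
      (ℤ.+≤+ h))))
  sq-lower k n (mkℚ -[1+ p ] d _) (*≤* ()) _

  sq-upper : ∀ k n a → 0ℚ ℚ.≤ a → ℤ.∣ ↥ a ∣ ℕ.* (suc n ℕ.* suc n) ℕ.< k ℕ.* k ℕ.* ↧ₙ a →
    a ℚ.< (+ k / suc n) ℚ.* (+ k / suc n)
  sq-upper k n (mkℚ (+ p) d _) _ h = ℚ.toℚᵘ-cancel-<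
    (ℚᵘ.<-respʳ-≃ (ℚᵘ.≃-sym (toℚᵘ-sq k n)) (ℚᵘ.*<* (subst₂ ℤ._<_
      (ℤ.pos-* p (suc n ℕ.* suc n))
      (trans (ℤ.pos-* (k ℕ.* k) (suc d)) (cong (ℤ._* + suc d) (ℤ.pos-* k k)))
      (ℤ.+<+ h))))
  sq-upper k n (mkℚ -[1+ p ] d _) (*≤* ()) _

  suc-/ : ∀ k n → + suc k / suc n ≡ (+ k / suc n) ℚ.+ (+ 1 / suc n)
  suc-/ k n = ℚ.toℚᵘ-injective (ℚᵘ.≃-trans (ℚ.toℚᵘ-fromℚᵘ (mkℚᵘ (+ suc k) n))
    (ℚᵘ.≃-sym (ℚᵘ.≃-trans (ℚ.toℚᵘ-homo-+ (+ k / suc n) (+ 1 / suc n))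
      (ℚᵘ.≃-trans (ℚᵘ.+-cong (ℚ.toℚᵘ-fromℚᵘ (mkℚᵘ (+ k) n)) (ℚ.toℚᵘ-fromℚᵘ (mkℚᵘ (+ 1) n)))
        (ℚᵘ.*≡* eq)))))
    where
    N = + suc n
    eq : (+ k ℤ.* N ℤ.+ + 1 ℤ.* N) ℤ.* N ≡ + suc k ℤ.* + (suc n ℕ.* suc n)
    eq = trans (cong (ℤ._* N) (sym (ℤ.*-distribʳ-+ N (+ k) (+ 1))))
      (trans (cong (λ j → (j ℤ.* N) ℤ.* N) (cong +_ (ℕ.+-comm k 1)))
      (trans (ℤ.*-assoc (+ suc k) N N) (cong (+ suc k ℤ.*_) (sym (ℤ.pos-* (suc n) (suc n))))))

  0≤⊔ : ∀ a → 0ℚ ℚ.≤ 0ℚ ℚ.⊔ a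
  0≤⊔ a = ℚ.p≤p⊔q 0ℚ a

0≤root-approx : ∀ n a → 0ℚ ℚ.≤ root-approx n a
0≤root-approx n a = ℚ.nonNegative⁻¹ (root-approx n a)
  {{ℚ.normalize-nonNeg (root-numerator (suc n) (0ℚ ℚ.⊔ a)) (suc n)}}

root-approx-lower : ∀ n a → root-approx n a ℚ.* root-approx n a ℚ.≤ 0ℚ ℚ.⊔ a
root-approx-lower n a = sq-lower k n a⁺ (0≤⊔ a)
  (ℕ.≤-trans (ℕ.*-monoˡ-≤ (↧ₙ a⁺) (isqrt-lower (v ℕ./ ↧ₙ a⁺))) (ℕ.m/n*n≤m v (↧ₙ a⁺)))
  where
  a⁺ = 0ℚ ℚ.⊔ a
  v = ℤ.∣ ↥ a⁺ ∣ ℕ.* (suc n ℕ.* suc n)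
  k = root-numerator (suc n) a⁺

root-approx-upper : ∀ n a →
  0ℚ ℚ.⊔ a ℚ.< (root-approx n a ℚ.+ (+ 1 / suc n)) ℚ.* (root-approx n a ℚ.+ (+ 1 / suc n))
root-approx-upper n a = subst (λ s → a⁺ ℚ.< s ℚ.* s) (suc-/ k n)
  (sq-upper (suc k) n a⁺ (0≤⊔ a) (ℕ.<-≤-trans
    (subst (ℕ._< suc (v ℕ./ d) ℕ.* d) (sym (ℕ.m≡m%n+[m/n]*n v d))
      (ℕ.+-monoˡ-< ((v ℕ./ d) ℕ.* d) (ℕ.m%n<n v d)))
    (ℕ.*-monoˡ-≤ d (isqrt-upper (v ℕ./ d)))))
  where
  a⁺ = 0ℚ ℚ.⊔ a
  d = ↧ₙ a⁺
  v = ℤ.∣ ↥ a⁺ ∣ ℕ.* (suc n ℕ.* suc n)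
  k = root-numerator (suc n) a⁺

private
  -- If s ≥ t + u + δ then s² ≥ (t + u)² + δ².
  sq-gap : ∀ s t u δ → 0ℚ ℚ.≤ t → 0ℚ ℚ.≤ u → 0ℚ ℚ.≤ δ → (t ℚ.+ u) ℚ.+ δ ℚ.≤ s →
    (t ℚ.+ u) ℚ.* (t ℚ.+ u) ℚ.+ δ ℚ.* δ ℚ.≤ s ℚ.* s
  sq-gap s t u δ 0≤t 0≤u 0≤δ h = begin
    w ℚ.* w ℚ.+ δ ℚ.* δ
      ≡⟨ ℚ.+-identityʳ (w ℚ.* w ℚ.+ δ ℚ.* δ) ⟨
    w ℚ.* w ℚ.+ δ ℚ.* δ ℚ.+ 0ℚ
      ≤⟨ ℚ.+-monoʳ-≤ (w ℚ.* w ℚ.+ δ ℚ.* δ) (ℚ.+-mono-≤ 0≤wδ 0≤wδ) ⟩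
    w ℚ.* w ℚ.+ δ ℚ.* δ ℚ.+ (w ℚ.* δ ℚ.+ w ℚ.* δ)
      ≡⟨ solve 2 (λ w δ → w :* w :+ δ :* δ :+ (w :* δ :+ w :* δ) := (w :+ δ) :* (w :+ δ)) refl w δ ⟩
    (w ℚ.+ δ) ℚ.* (w ℚ.+ δ)
      ≤⟨ *-mono-≤ 0≤wd (ℚ.≤-trans 0≤wd h) h h ⟩
    s ℚ.* s ∎
    where
    open ℚ.≤-Reasoning
    w = t ℚ.+ u
    0≤w : 0ℚ ℚ.≤ w
    0≤w = ℚ.+-mono-≤ 0≤t 0≤u
    0≤wd : 0ℚ ℚ.≤ w ℚ.+ δ
    0≤wd = ℚ.+-mono-≤ 0≤w 0≤δ
    0≤wδ : 0ℚ ℚ.≤ w ℚ.* δ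
    0≤wδ = *-mono-≤ {0ℚ} {w} {0ℚ} {δ} ℚ.≤-refl 0≤w 0≤w 0≤δ

  ⊔-lipschitz : ∀ a b → 0ℚ ℚ.⊔ a ℚ.≤ (0ℚ ℚ.⊔ b) ℚ.+ ℚ.∣ a ℚ.- b ∣
  ⊔-lipschitz a b = ℚ.⊔-lub
    (ℚ.+-mono-≤ (0≤⊔ b) (ℚ.0≤∣p∣ (a ℚ.- b)))
    (ℚ.≤-trans (p≤q+∣p-q∣ a b) (ℚ.+-monoˡ-≤ ℚ.∣ a ℚ.- b ∣ (ℚ.p≤q⊔p 0ℚ b)))

  0≤1/n : ∀ n → 0ℚ ℚ.≤ + 1 / suc n
  0≤1/n n = ℚ.nonNegative⁻¹ (+ 1 / suc n) {{ℚ.normalize-nonNeg 1 (suc n)}}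

private
  sq-close : ∀ s t u δ a b D → 0ℚ ℚ.≤ t → 0ℚ ℚ.≤ u → 0ℚ ℚ.≤ δ →
    s ℚ.* s ℚ.≤ a → b ℚ.< (t ℚ.+ u) ℚ.* (t ℚ.+ u) → a ℚ.≤ b ℚ.+ D → D ℚ.≤ δ ℚ.* δ →
    s ℚ.≤ (t ℚ.+ u) ℚ.+ δ
  sq-close s t u δ a b D 0≤t 0≤u 0≤δ s²≤a b<[t+u]² a≤b+D D≤δ² with ℚ.≤-total s ((t ℚ.+ u) ℚ.+ δ)
  ... | inj₁ r = r
  ... | inj₂ r = contradiction
    (ℚ.≤-<-trans a≤b+D (ℚ.<-≤-trans (ℚ.+-mono-<-≤ b<[t+u]² D≤δ²)
      (ℚ.≤-trans (sq-gap s t u δ 0≤t 0≤u 0≤δ r) s²≤a)))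
    (ℚ.<-irrefl refl)

root-approx-close : ∀ m n a b δ → 0ℚ ℚ.≤ δ → ℚ.∣ a ℚ.- b ∣ ℚ.≤ δ ℚ.* δ →
  root-approx m a ℚ.≤ (root-approx n b ℚ.+ (+ 1 / suc n)) ℚ.+ δ
root-approx-close m n a b δ 0≤δ h = sq-close
  (root-approx m a) (root-approx n b) (+ 1 / suc n) δ (0ℚ ℚ.⊔ a) (0ℚ ℚ.⊔ b) ℚ.∣ a ℚ.- b ∣
  (0≤root-approx n b) (0≤1/n n) 0≤δ
  (root-approx-lower m a) (root-approx-upper n b) (⊔-lipschitz a b) h

archimedean : ∀ ε → 0ℚ ℚ.< ε → ∃[ N ] (∀ n → N ℕ.≤ n → + 1 / suc n ℚ.≤ ε)
archimedean (mkℚ (+ zero) d _) (*<* (ℤ.+<+ ()))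
archimedean (mkℚ -[1+ p ] d _) (*<* ())
archimedean ε@(mkℚ (+ suc p) d _) _ = d , λ n d≤n → ℚ.toℚᵘ-cancel-≤
  (ℚᵘ.≤-respˡ-≃ (ℚᵘ.≃-sym (ℚ.toℚᵘ-fromℚᵘ (mkℚᵘ (+ 1) n)))
    (ℚᵘ.*≤* (subst₂ ℤ._≤_ (ℤ.pos-* 1 (suc d)) (ℤ.pos-* (suc p) (suc n))
      (ℤ.+≤+ (ℕ.*-mono-≤ (ℕ.s≤s (ℕ.z≤n {p})) (ℕ.s≤s d≤n))))))

private
  √-cauchy : ∀ {x} → Cauchy x → Cauchy (λ n → root-approx n (x n))
  √-cauchy {x} cx ε 0<ε = N , λ m n N≤m N≤n →
    ∣p-q∣≤r (root-approx m (x m)) (root-approx n (x n)) ε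
      (one-sided m n N≤m N≤n) (one-sided n m N≤n N≤m)
    where
    open ℚ.≤-Reasoning
    δ = ½ ℚ.* ε
    0<δ : 0ℚ ℚ.< δ
    0<δ = half-pos 0<ε
    0<δ² : 0ℚ ℚ.< δ ℚ.* δ
    0<δ² = subst (ℚ._< δ ℚ.* δ) (ℚ.*-zeroʳ δ) (ℚ.*-monoʳ-<-pos δ {{ℚ.positive 0<δ}} 0<δ)
    X = cx (δ ℚ.* δ) 0<δ²
    Y = archimedean δ 0<δ
    N = proj₁ X ℕ.⊔ proj₁ Y
    X≤ = ℕ.m≤m⊔n (proj₁ X) (proj₁ Y)
    Y≤ = ℕ.m≤n⊔m (proj₁ X) (proj₁ Y)
    one-sided : ∀ m n → N ℕ.≤ m → N ℕ.≤ n → root-approx m (x m) ℚ.≤ root-approx n (x n) ℚ.+ ε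
    one-sided m n N≤m N≤n = begin
      root-approx m (x m)
        ≤⟨ root-approx-close m n (x m) (x n) δ (ℚ.<⇒≤ 0<δ)
             (proj₂ X m n (ℕ.≤-trans X≤ N≤m) (ℕ.≤-trans X≤ N≤n)) ⟩
      (root-approx n (x n) ℚ.+ (+ 1 / suc n)) ℚ.+ δ
        ≤⟨ ℚ.+-monoˡ-≤ δ (ℚ.+-monoʳ-≤ (root-approx n (x n)) (proj₂ Y n (ℕ.≤-trans Y≤ N≤n))) ⟩
      (root-approx n (x n) ℚ.+ δ) ℚ.+ δ
        ≡⟨ ℚ.+-assoc (root-approx n (x n)) δ δ ⟩
      root-approx n (x n) ℚ.+ (δ ℚ.+ δ)
        ≡⟨ cong (root-approx n (x n) ℚ.+_) (halves ε) ⟩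
      root-approx n (x n) ℚ.+ ε ∎

-- The square root of max 0 x.
√_ : ℝ → ℝ
√ x = mkℝ (λ n → root-approx n (seq x n)) (√-cauchy {seq x} (cauchy x))

infix 9 √_

record ℂ : Set where
  constructor _+i_
  field
    re im : ℝ

open ℂ public

infix  4 _≈ᶜ_
infixl 7 _*ᶜ_
infixl 6 _+ᶜ_

_≈ᶜ_ : ℂ → ℂ → Set
z ≈ᶜ w = (re z ≈ᴿ re w) × (im z ≈ᴿ im w)

0ᶜ 1ᶜ : ℂ
0ᶜ = 0ᴿ +i 0ᴿ
1ᶜ = 1ᴿ +i 0ᴿ

_+ᶜ_ : ℂ → ℂ → ℂ
z +ᶜ w = (re z +ᴿ re w) +i (im z +ᴿ im w)

_*ᶜ_ : ℂ → ℂ → ℂ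
z *ᶜ w = (re z *ᴿ re w -ᴿ im z *ᴿ im w) +i (re z *ᴿ im w +ᴿ im z *ᴿ re w)

∣_∣ᶜ : ℂ → ℝ
∣ z ∣ᶜ = √ (re z *ᴿ re z +ᴿ im z *ᴿ im z)

+ᶜ-rawMonoid : RawMonoid 0ℓ 0ℓ
+ᶜ-rawMonoid = record { Carrier = ℂ ; _≈_ = _≈ᶜ_ ; _∙_ = _+ᶜ_ ; ε = 0ᶜ }

∑ : ∀ {n} → Subset n → (Fin n → ℂ) → ℂ
∑ A f = RawMonoidDefinitions.sum +ᶜ-rawMonoid (λ i → if lookup A i then f i else 0ᶜ)

infixr 5 ∑
syntax ∑ A (λ i → z) = ∑[ i ∈ A ] z

record FiniteField (c ℓ : Level) (q : ℕ) : Set (lsuc (c ⊔ ℓ)) where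
  field
    commutativeRing : CommutativeRing c ℓ

  open CommutativeRing commutativeRing public

  field
    1≉0         : ¬ (1# ≈ 0#)
    invertible  : ∀ x → ¬ (x ≈ 0#) → ∃[ y ] x * y ≈ 1#
    enumeration : Inverse (≡-setoid (Fin q)) setoid

  -- Subsets of the field are represented by subsets of Fin q through this
  -- bijection.
  element : Fin q → Carrier
  element = Inverse.to enumeration

  q-nonZero : ℕ.NonZero q
  q-nonZero = inhabited (Inverse.from enumeration 0#)
    where
    inhabited : ∀ {n} → Fin n → ℕ.NonZero n
    inhabited {suc _} _ = _

  density : Subset q → ℚ
  density A = (+ ∣ A ∣ / q) {{q-nonZero}}

record MultiplicativeCharacter {c ℓ : Level} {q : ℕ} (F : FiniteField c ℓ q) : Set (c ⊔ ℓ) where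
  open FiniteField F
  field
    ⟦_⟧     : Carrier → ℂ
    ⟦⟧-cong : ∀ {x y} → x ≈ y → ⟦ x ⟧ ≈ᶜ ⟦ y ⟧
    nonzero : ∀ x → ¬ (x ≈ 0#) → ¬ (⟦ x ⟧ ≈ᶜ 0ᶜ)
    homo    : ∀ x y → ¬ (x ≈ 0#) → ¬ (y ≈ 0#) → ⟦ x * y ⟧ ≈ᶜ ⟦ x ⟧ *ᶜ ⟦ y ⟧
    at-0    : ⟦ 0# ⟧ ≈ᶜ 0ᶜ

  Trivial : Set (c ⊔ ℓ)
  Trivial = ∀ x → ¬ (x ≈ 0#) → ⟦ x ⟧ ≈ᶜ 1ᶜ

{-# OPTIONS --safe #-}

-- Write N(z) for |z|², α = |A|/q, β = |B|/q, and P(a) = ∑_{b ∈ B} χ(a + b).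
-- Since χ is non-trivial, ∑ₓ χ(x) = 0, so ∑ₐ P(a) = 0 and the sum in question
-- is S = ∑ₐ (1_A(a) − α) P(a). By Cauchy–Schwarz,
-- N(S) ≤ ∑ₐ (1_A(a) − α)² · ∑ₐ N(P(a)), whose first factor is |A| (1 − α).
-- The second is |B|² C + |B| (T − C), where T and C are the values at d = 0
-- and d ≠ 0 of the correlation W(d) = ∑_y Re χ(y + d) χ̄(y), which is
-- constant on d ≠ 0 by scaling y. Now T = q − 1, and ∑_d W(d) = 0 forces
-- C = −1, so the second factor is q |B| − |B|² = q |B| (1 − β).
--
-- Constructively, equality of reals is stable under double negation and ℝ has
-- no zero divisors; this replaces both choosing c with χ(c) ≠ 1 and dividing.
module Submission where

open import Defs
open import Algebra.Bundles using (CommutativeRing)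
import Algebra.Definitions.RawMonoid as RawMonoidDefinitions
import Algebra.Properties.Semiring.Sum as SemiringSum
import Algebra.Solver.Ring as RingSolver
open import Algebra.Solver.Ring.AlmostCommutativeRing using (_-Raw-AlmostCommutative⟶_; fromCommutativeRing; Induced-equivalence)
open import Algebra.Structures using (IsCommutativeRing)
open import Data.Bool.Base using (Bool; true; false; if_then_else_)
open import Data.Fin.Base using (Fin; zero; suc)
open import Data.Fin.Permutation using (permutation)
import Data.Fin.Properties as Fin
open import Data.Fin.Subset using (Subset; ∣_∣)
open import Data.Fin.Subset.Properties using (∣p∣≤n)
import Data.Integer.Properties as ℤ
open import Data.Maybe.Base using (Maybe; just; nothing)
open import Data.Nat.Base as ℕ using (ℕ; zero; suc)
open import Data.Nat.Divisibility using (_∣_)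
open import Data.Nat.Primality using (Prime)
import Data.Nat.Properties as ℕ
open import Data.Product.Base using (∃-syntax; _×_; _,_; proj₁; proj₂)
open import Data.Rational.Base as ℚ using (ℚ; 0ℚ; 1ℚ; ½; toℚᵘ)
import Data.Rational.Properties as ℚ
open import Data.Rational.Solver using (module +-*-Solver)
open import Data.Rational.Unnormalised.Base as ℚᵘ using (mkℚᵘ)
import Data.Rational.Unnormalised.Properties as ℚᵘ
open import Data.Sum.Base using (inj₁; inj₂)
open import Data.Vec.Base using (lookup; []; _∷_)
open import Function.Base using (_∘_)
open import Function.Bundles using (Inverse)
open import Level using (Level; 0ℓ)
open import Relation.Binary.Definitions using (Decidable)
open import Relation.Binary.PropositionalEquality as ≡ using (_≡_)
import Relation.Binary.Reasoning.Setoid as SetoidReasoning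
open import Relation.Nullary.Decidable.Core using (does; yes; no)
open import Relation.Nullary.Negation using (¬_; contradiction)

-- Character sums over a finite field, with values in an abstract ring

-- Characters are only assumed to take nonzero values, so |χ(x)| = 1 has to be derived; positivity
-- of ∑ |χ|² is what makes this possible. Complex arithmetic is replaced by real and imaginary
-- parts, and conjugation never appears as an operation. The algebra takes place in an abstract
-- commutative ring about which, beyond a map from ℚ, only three properties of ℝ are assumed:
-- stability of equality, absence of zero divisors, and definiteness of sums of squares.
-- Inequalities enter only afterwards and at the level of rational approximations: Cauchy-Schwarz is
-- proved over ℚ and holds exactly at every index of the approximating sequences, and the outer
-- square root is removed by comparing squares.

module _ {c ℓ : Level} {q} (F : FiniteField c ℓ q) where
  open FiniteField F
  open SetoidReasoning setoid

  index : Carrier → Fin q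
  index = Inverse.from enumeration

  element-index : ∀ x → element (index x) ≈ x
  element-index = Inverse.strictlyInverseˡ enumeration

  index-element : ∀ i → index (element i) ≡ i
  index-element = Inverse.strictlyInverseʳ enumeration

  index-cong : ∀ {x y} → x ≈ y → index x ≡ index y
  index-cong = Inverse.from-cong enumeration

  index-injective : ∀ {x y} → index x ≡ index y → x ≈ y
  index-injective {x} {y} eq = begin
    x                 ≈⟨ element-index x ⟨
    element (index x) ≡⟨ ≡.cong element eq ⟩
    element (index y) ≈⟨ element-index y ⟩
    y                 ∎

  -- The bijection with `Fin q` transports decidable equality to the field, so that arguments may
  -- split on whether an element is zero.
  ≈-decidable : Decidable _≈_
  ≈-decidable x y with index x Fin.≟ index y
  ... | yes eq = yes (index-injective eq)
  ... | no neq = no λ x≈y → neq (index-cong x≈y)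

  cancel-+- : ∀ x y → x + y - y ≈ x
  cancel-+- x y = trans (+-assoc x y (- y)) (trans (+-congˡ (-‿inverseʳ y)) (+-identityʳ x))

  cancel--+ : ∀ x y → x - y + y ≈ x
  cancel--+ x y = trans (+-assoc x (- y) y) (trans (+-congˡ (-‿inverseˡ y)) (+-identityʳ x))

module CharacterSums {r ρ c ℓ : Level} (R : CommutativeRing r ρ)
  (ℚ⟶R : CommutativeRing.rawRing ℚ.+-*-commutativeRing -Raw-AlmostCommutative⟶ fromCommutativeRing R)
  {q : ℕ} (F : FiniteField c ℓ q) where

  open CommutativeRing R hiding (zero)
  private module F = FiniteField F
  open SemiringSum semiring
  open SetoidReasoning setoid
  open import Algebra.Properties.Ring ring using (-0#≈0#; x∙y⁻¹≈ε⇒x≈y)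

  private
    -- The solver has to compare coefficients, and equality of reals is not decidable; hence
    -- coefficients are taken from ℚ.
    coefficient≟ : ∀ a b → Maybe (Induced-equivalence ℚ⟶R a b)
    coefficient≟ a b with a ℚ.≟ b
    ... | yes a≡b = just (reflexive (≡.cong (_-Raw-AlmostCommutative⟶_.⟦_⟧ ℚ⟶R) a≡b))
    ... | no  _   = nothing

  open RingSolver (CommutativeRing.rawRing ℚ.+-*-commutativeRing) (fromCommutativeRing R) ℚ⟶R
    coefficient≟ using (solve; _:=_; _:+_; _:*_; _:-_; :-_)

  -- The functions u and v are the real and imaginary parts of the character.
  module Character
    (stable : ∀ x y → ¬ ¬ (x ≈ y) → x ≈ y)
    (integral : ∀ x y → x * y ≈ 0# → ¬ (x ≈ 0#) → y ≈ 0#)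
    (definite : ∀ {n} (f g : Fin n → Carrier) →
      sum (λ i → f i * f i + g i * g i) ≈ 0# → ∀ i → (f i ≈ 0#) × (g i ≈ 0#))
    (u v : F.Carrier → Carrier)
    (u-cong : ∀ {x y} → x F.≈ y → u x ≈ u y)
    (v-cong : ∀ {x y} → x F.≈ y → v x ≈ v y)
    (nonzero : ∀ x → ¬ (x F.≈ F.0#) → ¬ ((u x ≈ 0#) × (v x ≈ 0#)))
    (u-homo : ∀ x y → ¬ (x F.≈ F.0#) → ¬ (y F.≈ F.0#) → u (x F.* y) ≈ u x * u y - v x * v y)
    (v-homo : ∀ x y → ¬ (x F.≈ F.0#) → ¬ (y F.≈ F.0#) → v (x F.* y) ≈ u x * v y + v x * u y)
    (u-at-0 : u F.0# ≈ 0#)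
    (v-at-0 : v F.0# ≈ 0#)
    (nontrivial : ¬ (∀ x → ¬ (x F.≈ F.0#) → (u x ≈ 1#) × (v x ≈ 0#)))
    where

    private
      cancelˡ : ∀ {x y z} → ¬ (x ≈ 0#) → x * y ≈ x * z → y ≈ z
      cancelˡ {x} {y} {z} x≉0 xy≈xz = x∙y⁻¹≈ε⇒x≈y y z (integral x (y - z) (begin
        x * (y - z)   ≈⟨ solve 3 (λ x y z → x :* (y :- z) := x :* y :- x :* z) refl x y z ⟩
        x * y - x * z ≈⟨ +-congʳ xy≈xz ⟩
        x * z - x * z ≈⟨ -‿inverseʳ (x * z) ⟩
        0#            ∎) x≉0)

      definite₂ : ∀ x y → x * x + y * y ≈ 0# → (x ≈ 0#) × (y ≈ 0#)
      definite₂ x y h = definite {1} (λ _ → x) (λ _ → y) (trans (+-identityʳ _) h) zero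

      sum-zero : ∀ {n} {f : Fin n → Carrier} → (∀ i → f i ≈ 0#) → sum f ≈ 0#
      sum-zero {n} f≈0 = trans (sum-cong-≋ f≈0) (sum-replicate-zero n)

      sum-*-sum : ∀ {m n} (f : Fin m → Carrier) (g : Fin n → Carrier) →
        sum f * sum g ≈ sum (λ i → sum (λ j → f i * g j))
      sum-*-sum f g = trans (*-distribʳ-sum (sum g) f) (sum-cong-≋ λ i → *-distribˡ-sum (f i) g)

    -- Branching on `does` makes `δ (suc i) (suc j)` reduce to `δ i j`, on which the recursion in
    -- `sum-δ` relies.
    δ : ∀ {n} → Fin n → Fin n → Carrier
    δ i j = if does (i Fin.≟ j) then 1# else 0#

    δ-same : ∀ {n} {i j : Fin n} → i ≡ j → δ i j ≈ 1#
    δ-same {i = i} {j} i≡j with i Fin.≟ j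
    ... | yes _   = refl
    ... | no  i≢j = contradiction i≡j i≢j

    δ-different : ∀ {n} {i j : Fin n} → ¬ (i ≡ j) → δ i j ≈ 0#
    δ-different {i = i} {j} i≢j with i Fin.≟ j
    ... | yes i≡j = contradiction i≡j i≢j
    ... | no  _   = refl

    sum-δ : ∀ {n} (f : Fin n → Carrier) j → sum (λ i → δ i j * f i) ≈ f j
    sum-δ f zero = begin
      1# * f zero + sum (λ i → 0# * f (suc i)) ≈⟨ +-cong (*-identityˡ _) (sum-zero λ i → zeroˡ (f (suc i))) ⟩
      f zero + 0#                              ≈⟨ +-identityʳ _ ⟩
      f zero                                   ∎
    sum-δ f (suc j) = begin
      0# * f zero + sum (λ i → δ i j * f (suc i)) ≈⟨ +-cong (zeroˡ (f zero)) (sum-δ (f ∘ suc) j) ⟩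
      0# + f (suc j)                              ≈⟨ +-identityˡ _ ⟩
      f (suc j)                                   ∎

    -- Sums over the field, invariant under translation and scaling

    ∑F : (F.Carrier → Carrier) → Carrier
    ∑F φ = sum (λ i → φ (F.element i))

    private
      ∑F-cong : ∀ {φ ψ} → (∀ x → φ x ≈ ψ x) → ∑F φ ≈ ∑F ψ
      ∑F-cong φ≈ψ = sum-cong-≋ (λ i → φ≈ψ (F.element i))

    -- Conjugating by the enumeration turns `h` and `k` into mutually inverse permutations of
    -- `Fin q`. The congruence hypotheses are there because `element (index x)` returns `x` only up
    -- to `≈`.
    reindex : ∀ φ (h k : F.Carrier → F.Carrier) →
      (∀ {x y} → x F.≈ y → φ x ≈ φ y) →
      (∀ {x y} → x F.≈ y → h x F.≈ h y) → (∀ {x y} → x F.≈ y → k x F.≈ k y) →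
      (∀ x → h (k x) F.≈ x) → (∀ x → k (h x) F.≈ x) →
      ∑F (φ ∘ h) ≈ ∑F φ
    reindex φ h k φ-cong h-cong k-cong hk kh = begin
      ∑F (φ ∘ h)                            ≈⟨ sum-cong-≋ (λ i → φ-cong (element-index F (h (F.element i)))) ⟨
      sum (λ i → φ (F.element (on h i)))    ≈⟨ sum-permute (φ ∘ F.element) (permutation (on h) (on k) (inverse h k h-cong hk) (inverse k h k-cong kh)) ⟨
      ∑F φ                                  ∎
      where
      on : (F.Carrier → F.Carrier) → Fin q → Fin q
      on f i = index F (f (F.element i))
      inverse : ∀ f g → (∀ {x y} → x F.≈ y → f x F.≈ f y) → (∀ x → f (g x) F.≈ x) → ∀ i → on f (on g i) ≡ i
      inverse f g f-cong fg i = ≡.trans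
        (index-cong F (F.trans (f-cong (element-index F _)) (fg (F.element i))))
        (index-element F i)

    ∑F-shift : ∀ φ → (∀ {x y} → x F.≈ y → φ x ≈ φ y) → ∀ d → ∑F (λ x → φ (x F.+ d)) ≈ ∑F φ
    ∑F-shift φ φ-cong d = reindex φ (F._+ d) (F._- d) φ-cong F.+-congʳ F.+-congʳ
      (λ x → cancel--+ F x d) (λ x → cancel-+- F x d)

    ∑F-scale : ∀ φ → (∀ {x y} → x F.≈ y → φ x ≈ φ y) → ∀ d → ¬ (d F.≈ F.0#) →
      ∑F (λ x → φ (d F.* x)) ≈ ∑F φ
    ∑F-scale φ φ-cong d d≉0 = reindex φ (d F.*_) (d⁻¹ F.*_) φ-cong F.*-congˡ F.*-congˡ
      (λ x → F.trans (F.sym (F.*-assoc d d⁻¹ x)) (F.trans (F.*-congʳ dd⁻¹≈1) (F.*-identityˡ x)))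
      (λ x → F.trans (F.sym (F.*-assoc d⁻¹ d x))
        (F.trans (F.*-congʳ (F.trans (F.*-comm d⁻¹ d) dd⁻¹≈1)) (F.*-identityˡ x)))
      where
      d⁻¹ = proj₁ (F.invertible d d≉0)
      dd⁻¹≈1 = proj₂ (F.invertible d d≉0)

    -- Multiplicativity and absolute value of the character

    private
      u-zero : ∀ {x} → x F.≈ F.0# → u x ≈ 0#
      u-zero x≈0 = trans (u-cong x≈0) u-at-0

      v-zero : ∀ {x} → x F.≈ F.0# → v x ≈ 0#
      v-zero x≈0 = trans (v-cong x≈0) v-at-0

      0*y-0*z : ∀ y z → 0# * y - 0# * z ≈ 0#
      0*y-0*z y z = trans (+-cong (zeroˡ y) (-‿cong (zeroˡ z))) (-‿inverseʳ 0#)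

      0*y+0*z : ∀ y z → 0# * y + 0# * z ≈ 0#
      0*y+0*z y z = trans (+-cong (zeroˡ y) (zeroˡ z)) (+-identityʳ 0#)

    -- If `y` is zero both sides vanish, since χ(0) = 0. The second factor may therefore run over
    -- the whole field, as it does under `∑F`.
    u-* : ∀ x y → ¬ (x F.≈ F.0#) → u (x F.* y) ≈ u x * u y - v x * v y
    u-* x y x≉0 with ≈-decidable F y F.0#
    ... | no  y≉0 = u-homo x y x≉0 y≉0
    ... | yes y≈0 = begin
      u (x F.* y)           ≈⟨ u-zero (F.trans (F.*-congˡ y≈0) (F.zeroʳ x)) ⟩
      0#                    ≈⟨ 0*y-0*z (u x) (v x) ⟨
      0# * u x - 0# * v x   ≈⟨ +-cong (*-comm 0# (u x)) (-‿cong (*-comm 0# (v x))) ⟩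
      u x * 0# - v x * 0#   ≈⟨ +-cong (*-congˡ (u-zero y≈0)) (-‿cong (*-congˡ (v-zero y≈0))) ⟨
      u x * u y - v x * v y ∎

    v-* : ∀ x y → ¬ (x F.≈ F.0#) → v (x F.* y) ≈ u x * v y + v x * u y
    v-* x y x≉0 with ≈-decidable F y F.0#
    ... | no  y≉0 = v-homo x y x≉0 y≉0
    ... | yes y≈0 = begin
      v (x F.* y)           ≈⟨ v-zero (F.trans (F.*-congˡ y≈0) (F.zeroʳ x)) ⟩
      0#                    ≈⟨ 0*y+0*z (u x) (v x) ⟨
      0# * u x + 0# * v x   ≈⟨ +-cong (*-comm 0# (u x)) (*-comm 0# (v x)) ⟩
      u x * 0# + v x * 0#   ≈⟨ +-cong (*-congˡ (v-zero y≈0)) (*-congˡ (u-zero y≈0)) ⟨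
      u x * v y + v x * u y ∎

    -- ⟪ x , y ⟫ is the real part of χ(x) times the conjugate of χ(y).
    ⟪_,_⟫ : F.Carrier → F.Carrier → Carrier
    ⟪ x , y ⟫ = u x * u y + v x * v y

    ⟪⟫-cong : ∀ {x x′ y y′} → x F.≈ x′ → y F.≈ y′ → ⟪ x , y ⟫ ≈ ⟪ x′ , y′ ⟫
    ⟪⟫-cong x≈ y≈ = +-cong (*-cong (u-cong x≈) (u-cong y≈)) (*-cong (v-cong x≈) (v-cong y≈))

    ⟪⟫-congˡ : ∀ {x x′} y → x F.≈ x′ → ⟪ x , y ⟫ ≈ ⟪ x′ , y ⟫
    ⟪⟫-congˡ y x≈ = ⟪⟫-cong {y = y} x≈ F.refl

    norm : F.Carrier → Carrier
    norm x = ⟪ x , x ⟫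

    -- The factor χ(d) meets its own conjugate and leaves |χ(d)|². In real and imaginary parts this
    -- is the polarised Brahmagupta-Fibonacci identity.
    ⟪⟫-scale : ∀ d x y → ¬ (d F.≈ F.0#) → ⟪ d F.* x , d F.* y ⟫ ≈ norm d * ⟪ x , y ⟫
    ⟪⟫-scale d x y d≉0 = begin
      ⟪ d F.* x , d F.* y ⟫
        ≈⟨ +-cong (*-cong (u-* d x d≉0) (u-* d y d≉0)) (*-cong (v-* d x d≉0) (v-* d y d≉0)) ⟩
      (u d * u x - v d * v x) * (u d * u y - v d * v y) + (u d * v x + v d * u x) * (u d * v y + v d * u y)
        ≈⟨ solve 6 (λ a b c d e f →
             (a :* c :- b :* d) :* (a :* e :- b :* f) :+ (a :* d :+ b :* c) :* (a :* f :+ b :* e)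
             := (a :* a :+ b :* b) :* (c :* e :+ d :* f)) refl (u d) (v d) (u x) (v x) (u y) (v y) ⟩
      norm d * ⟪ x , y ⟫ ∎

    total-norm : Carrier
    total-norm = ∑F norm

    -- A vanishing sum of squares would force every χ(x) to vanish, but χ(1) does not.
    total-norm≉0 : ¬ (total-norm ≈ 0#)
    total-norm≉0 T≈0 = nonzero F.1# F.1≉0 (trans (sym (u-cong (element-index F F.1#))) (proj₁ vanishing) ,
                                           trans (sym (v-cong (element-index F F.1#))) (proj₂ vanishing))
      where
      vanishing = definite (u ∘ F.element) (v ∘ F.element) T≈0 (index F F.1#)

    -- Scaling by x permutes the field, so total-norm = norm x * total-norm.
    norm≈1 : ∀ x → ¬ (x F.≈ F.0#) → norm x ≈ 1#
    norm≈1 x x≉0 = cancelˡ total-norm≉0 (begin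
      total-norm * norm x                 ≈⟨ *-comm total-norm (norm x) ⟩
      norm x * total-norm                 ≈⟨ *-distribˡ-sum (norm x) (norm ∘ F.element) ⟩
      ∑F (λ y → norm x * norm y)          ≈⟨ ∑F-cong (λ y → ⟪⟫-scale x y y x≉0) ⟨
      ∑F (λ y → norm (x F.* y))           ≈⟨ ∑F-scale norm (λ e → ⟪⟫-cong e e) x x≉0 ⟩
      total-norm                          ≈⟨ *-identityʳ total-norm ⟨
      total-norm * 1#                     ∎)

    -- Vanishing of the full character sum

    private
      ∑u ∑v : Carrier
      ∑u = ∑F u
      ∑v = ∑F v

      ∑-linear : ∀ a b → ∑F (λ y → a * u y + b * v y) ≈ a * ∑u + b * ∑v
      ∑-linear a b = trans (∑-distrib-+ (λ i → a * u (F.element i)) (λ i → b * v (F.element i)))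
        (+-cong (sym (*-distribˡ-sum a (u ∘ F.element))) (sym (*-distribˡ-sum b (v ∘ F.element))))

      -- Here `a` and `b` are the real and imaginary parts of χ(x) - 1. Scaling by x permutes the
      -- field, so (χ(x) - 1) ∑χ = 0, whose two parts are `fixed-u` and `fixed-v`. Multiplying by
      -- the conjugate of χ(x) - 1 decouples them into |χ(x) - 1|² times each part of the sum.
      module Rotation (x : F.Carrier) (x≉0 : ¬ (x F.≈ F.0#)) where
        a b : Carrier
        a = u x - 1#
        b = v x

        fixed-u : a * ∑u - b * ∑v ≈ 0#
        fixed-u = begin
          (u x - 1#) * ∑u - b * ∑v
            -- The unit is passed to the solver as a variable `e`: a solver constant would denote
            -- the image of a rational, which agrees with `1#` only up to `≈`.
            ≈⟨ solve 5 (λ p e b s t → (p :- e) :* s :- b :* t := (p :* s :+ :- b :* t) :- e :* s)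
                 refl (u x) 1# b ∑u ∑v ⟩
          (u x * ∑u + - b * ∑v) - 1# * ∑u
            ≈⟨ +-cong (sym (∑-linear (u x) (- b))) (-‿cong (*-identityˡ ∑u)) ⟩
          ∑F (λ y → u x * u y + - b * v y) - ∑u
            ≈⟨ +-congʳ (∑F-cong λ y → trans (u-* x y x≉0)
                 (solve 4 (λ p b r s → p :* r :- b :* s := p :* r :+ :- b :* s) refl (u x) b (u y) (v y))) ⟨
          ∑F (λ y → u (x F.* y)) - ∑u
            ≈⟨ +-congʳ (∑F-scale u u-cong x x≉0) ⟩
          ∑u - ∑u
            ≈⟨ -‿inverseʳ ∑u ⟩
          0# ∎

        fixed-v : a * ∑v + b * ∑u ≈ 0#
        fixed-v = begin
          (u x - 1#) * ∑v + b * ∑u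
            ≈⟨ solve 5 (λ p e b s t → (p :- e) :* t :+ b :* s := (b :* s :+ p :* t) :- e :* t)
                 refl (u x) 1# b ∑u ∑v ⟩
          (b * ∑u + u x * ∑v) - 1# * ∑v
            ≈⟨ +-cong (sym (∑-linear b (u x))) (-‿cong (*-identityˡ ∑v)) ⟩
          ∑F (λ y → b * u y + u x * v y) - ∑v
            ≈⟨ +-congʳ (∑F-cong λ y → trans (v-* x y x≉0) (+-comm (u x * v y) (b * u y))) ⟨
          ∑F (λ y → v (x F.* y)) - ∑v
            ≈⟨ +-congʳ (∑F-scale v v-cong x x≉0) ⟩
          ∑v - ∑v
            ≈⟨ -‿inverseʳ ∑v ⟩
          0# ∎

        annihilates-u : (a * a + b * b) * ∑u ≈ 0#
        annihilates-u = begin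
          (a * a + b * b) * ∑u
            ≈⟨ solve 4 (λ a b s t → (a :* a :+ b :* b) :* s
                 := a :* (a :* s :- b :* t) :+ b :* (a :* t :+ b :* s)) refl a b ∑u ∑v ⟩
          a * (a * ∑u - b * ∑v) + b * (a * ∑v + b * ∑u)
            ≈⟨ +-cong (*-congˡ fixed-u) (*-congˡ fixed-v) ⟩
          a * 0# + b * 0#
            ≈⟨ trans (+-cong (zeroʳ a) (zeroʳ b)) (+-identityʳ 0#) ⟩
          0# ∎

        annihilates-v : (a * a + b * b) * ∑v ≈ 0#
        annihilates-v = begin
          (a * a + b * b) * ∑v
            ≈⟨ solve 4 (λ a b s t → (a :* a :+ b :* b) :* t
                 := a :* (a :* t :+ b :* s) :+ (:- b) :* (a :* s :- b :* t)) refl a b ∑u ∑v ⟩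
          a * (a * ∑v + b * ∑u) + (- b) * (a * ∑u - b * ∑v)
            ≈⟨ +-cong (*-congˡ fixed-v) (*-congˡ fixed-u) ⟩
          a * 0# + (- b) * 0#
            ≈⟨ trans (+-cong (zeroʳ a) (zeroʳ (- b))) (+-identityʳ 0#) ⟩
          0# ∎

      -- Were `s` nonzero, cancelling it would give |χ(x) - 1|² = 0, hence χ(x) = 1, for every
      -- nonzero x. No particular x is ever exhibited: `stable` turns the refutation of `s ≉ 0` into
      -- the conclusion.
      annihilated : ∀ s → (∀ x → ¬ (x F.≈ F.0#) → ((u x - 1#) * (u x - 1#) + v x * v x) * s ≈ 0#) → s ≈ 0#
      annihilated s h = stable s 0# λ s≉0 → nontrivial λ x x≉0 →
        let d = definite₂ (u x - 1#) (v x) (integral s _ (trans (*-comm s _) (h x x≉0)) s≉0)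
        in x∙y⁻¹≈ε⇒x≈y (u x) 1# (proj₁ d) , proj₂ d

    ∑u≈0 : ∑F u ≈ 0#
    ∑u≈0 = annihilated ∑u Rotation.annihilates-u

    ∑v≈0 : ∑F v ≈ 0#
    ∑v≈0 = annihilated ∑v Rotation.annihilates-v

    -- Autocorrelation of the character

    correlation : F.Carrier → Carrier
    correlation d = ∑F (λ y → ⟪ y F.+ d , y ⟫)

    correlation-cong : ∀ {x y} → x F.≈ y → correlation x ≈ correlation y
    correlation-cong x≈y = ∑F-cong (λ z → ⟪⟫-congˡ z (F.+-congˡ {z} x≈y))

    correlation-0 : correlation F.0# ≈ total-norm
    correlation-0 = ∑F-cong (λ y → ⟪⟫-congˡ y (F.+-identityʳ y))

    correlation-const : ∀ d → ¬ (d F.≈ F.0#) → correlation d ≈ correlation F.1#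
    correlation-const d d≉0 = begin
      ∑F (λ y → ⟪ y F.+ d , y ⟫)
        ≈⟨ ∑F-scale (λ y → ⟪ y F.+ d , y ⟫) (λ e → ⟪⟫-cong (F.+-congʳ e) e) d d≉0 ⟨
      ∑F (λ y → ⟪ d F.* y F.+ d , d F.* y ⟫)
        ≈⟨ ∑F-cong (λ y → ⟪⟫-congˡ (d F.* y)
             (F.trans (F.+-congˡ (F.sym (F.*-identityʳ d))) (F.sym (F.distribˡ d y F.1#)))) ⟩
      ∑F (λ y → ⟪ d F.* (y F.+ F.1#) , d F.* y ⟫)
        ≈⟨ ∑F-cong (λ y → trans (⟪⟫-scale d (y F.+ F.1#) y d≉0) (trans (*-congʳ (norm≈1 d d≉0)) (*-identityˡ _))) ⟩
      correlation F.1# ∎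

    -- After exchanging the sums, χ(y + d) for fixed y runs through all values of χ as d varies, so
    -- each inner sum contains the factor ∑χ = 0.
    ∑-correlation : ∑F correlation ≈ 0#
    ∑-correlation = begin
      ∑F (λ d → ∑F (λ y → ⟪ y F.+ d , y ⟫))
        ≈⟨ ∑-comm (λ i j → ⟪ F.element j F.+ F.element i , F.element j ⟫) ⟩
      ∑F (λ y → ∑F (λ d → ⟪ y F.+ d , y ⟫))
        ≈⟨ ∑F-cong inner ⟩
      ∑F (λ _ → 0#)
        ≈⟨ sum-replicate-zero q ⟩
      0# ∎
      where
      shifted : ∀ φ → (∀ {x y} → x F.≈ y → φ x ≈ φ y) → ∑F φ ≈ 0# → ∀ y → ∑F (λ d → φ (y F.+ d) * φ y) ≈ 0#
      shifted φ φ-cong ∑φ≈0 y = begin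
        ∑F (λ d → φ (y F.+ d) * φ y)   ≈⟨ *-distribʳ-sum (φ y) (λ i → φ (y F.+ F.element i)) ⟨
        ∑F (λ d → φ (y F.+ d)) * φ y   ≈⟨ *-congʳ (∑F-cong (λ d → φ-cong (F.+-comm y d))) ⟩
        ∑F (λ d → φ (d F.+ y)) * φ y   ≈⟨ *-congʳ (trans (∑F-shift φ φ-cong y) ∑φ≈0) ⟩
        0# * φ y                       ≈⟨ zeroˡ (φ y) ⟩
        0#                             ∎
      inner : ∀ y → ∑F (λ d → ⟪ y F.+ d , y ⟫) ≈ 0#
      inner y = trans (∑-distrib-+ (λ i → u (y F.+ F.element i) * u y) (λ i → v (y F.+ F.element i) * v y))
        (trans (+-cong (shifted u u-cong ∑u≈0 y) (shifted v v-cong ∑v≈0 y)) (+-identityʳ 0#))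

    -- This is q inside the abstract ring; only in ℝ does `sum-𝟙` identify it with `fromℕ q`.
    order : Carrier
    order = sum {q} (λ _ → 1#)

    private
      D : Carrier
      D = total-norm - correlation F.1#

      index-0 : Fin q
      index-0 = index F F.0#

      -- A constant plus the excess `D` at zero: summing over all shifts then gives q C + D. The
      -- factor `1#` stays so that the constant part factors into C times `order`.
      split : ∀ i → correlation (F.element i) ≈ correlation F.1# * 1# + δ i index-0 * D
      split i with ≈-decidable F (F.element i) F.0#
      ... | yes i≈0 = begin
        correlation (F.element i)
          ≈⟨ trans (correlation-cong i≈0) correlation-0 ⟩
        total-norm
          ≈⟨ solve 2 (λ t c → t := c :+ (t :- c)) refl total-norm (correlation F.1#) ⟩
        correlation F.1# + D
          ≈⟨ +-cong (*-identityʳ _) (trans (*-congʳ (δ-same i≡0)) (*-identityˡ D)) ⟨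
        correlation F.1# * 1# + δ i index-0 * D ∎
        where
        i≡0 : i ≡ index-0
        i≡0 = ≡.trans (≡.sym (index-element F i)) (index-cong F i≈0)
      ... | no i≉0 = begin
        correlation (F.element i)
          ≈⟨ correlation-const (F.element i) i≉0 ⟩
        correlation F.1#
          ≈⟨ +-identityʳ _ ⟨
        correlation F.1# + 0#
          ≈⟨ +-cong (*-identityʳ _) (trans (*-congʳ (δ-different i≢0)) (zeroˡ D)) ⟨
        correlation F.1# * 1# + δ i index-0 * D ∎
        where
        i≢0 : ¬ (i ≡ index-0)
        i≢0 ≡.refl = i≉0 (element-index F F.0#)

      order*C+D≈0 : order * correlation F.1# + D ≈ 0#
      order*C+D≈0 = begin
        order * correlation F.1# + D
          ≈⟨ +-cong (trans (*-comm order _) (*-distribˡ-sum {q} (correlation F.1#) (λ _ → 1#))) (sym (sum-δ {q} (λ _ → D) index-0)) ⟩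
        sum {q} (λ _ → correlation F.1# * 1#) + sum (λ i → δ i index-0 * D)
          ≈⟨ ∑-distrib-+ {q} (λ _ → correlation F.1# * 1#) (λ i → δ i index-0 * D) ⟨
        sum (λ i → correlation F.1# * 1# + δ i index-0 * D)
          ≈⟨ sum-cong-≋ split ⟨
        ∑F correlation
          ≈⟨ ∑-correlation ⟩
        0# ∎

      -- The norm is 1 except at zero, where it is 0; adding a delta there fills the gap, which
      -- avoids counting the nonzero elements.
      T+1≈order : total-norm + 1# ≈ order
      T+1≈order = begin
        total-norm + 1#
          ≈⟨ +-congˡ (sum-δ {q} (λ _ → 1#) index-0) ⟨
        total-norm + sum (λ i → δ i index-0 * 1#)
          ≈⟨ ∑-distrib-+ (norm ∘ F.element) (λ i → δ i index-0 * 1#) ⟨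
        sum (λ i → norm (F.element i) + δ i index-0 * 1#)
          ≈⟨ sum-cong-≋ pointwise ⟩
        order ∎
        where
        pointwise : ∀ i → norm (F.element i) + δ i index-0 * 1# ≈ 1#
        pointwise i with ≈-decidable F (F.element i) F.0#
        ... | yes i≈0 = begin
          norm (F.element i) + δ i index-0 * 1#
            ≈⟨ +-cong (+-cong (trans (*-congʳ (u-zero i≈0)) (zeroˡ _)) (trans (*-congʳ (v-zero i≈0)) (zeroˡ _)))
                 (trans (*-identityʳ _) (δ-same (≡.trans (≡.sym (index-element F i)) (index-cong F i≈0)))) ⟩
          0# + 0# + 1#
            ≈⟨ trans (+-congʳ (+-identityˡ 0#)) (+-identityˡ 1#) ⟩
          1# ∎
        ... | no i≉0 = begin
          norm (F.element i) + δ i index-0 * 1#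
            ≈⟨ +-cong (norm≈1 _ i≉0)
                 (trans (*-identityʳ _) (δ-different (λ i≡0 → i≉0 (F.trans (F.reflexive (≡.cong F.element i≡0)) (element-index F F.0#))))) ⟩
          1# + 0#
            ≈⟨ +-identityʳ 1# ⟩
          1# ∎

      -- From T + 1 = q and q C + D = 0 follows T D = q D - D = T q - (q C + D) = T q. Here T can be
      -- cancelled because it is already known to be nonzero.
      D≈order : D ≈ order
      D≈order = cancelˡ total-norm≉0 (begin
        T * (T - C)
          ≈⟨ solve 3 (λ t c e → t :* (t :- c) := (t :+ e) :* (t :- c) :- e :* (t :- c)) refl T C 1# ⟩
        (T + 1#) * D - 1# * D
          ≈⟨ +-cong (*-congʳ T+1≈order) (-‿cong (*-identityˡ D)) ⟩
        order * (T - C) - D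
          ≈⟨ solve 4 (λ o t c d → o :* (t :- c) :- d := t :* o :- (o :* c :+ d)) refl order T C D ⟩
        T * order - (order * C + D)
          ≈⟨ +-congˡ (trans (-‿cong order*C+D≈0) -0#≈0#) ⟩
        T * order + 0#
          ≈⟨ +-identityʳ _ ⟩
        T * order ∎)
        where
        T = total-norm
        C = correlation F.1#

      C≈-1 : correlation F.1# ≈ - 1#
      C≈-1 = begin
        correlation F.1#
          ≈⟨ solve 3 (λ t c e → c := (t :+ e) :- (t :- c) :- e) refl total-norm (correlation F.1#) 1# ⟩
        (total-norm + 1#) - D - 1#
          ≈⟨ +-congʳ (+-cong T+1≈order (-‿cong D≈order)) ⟩
        order - order - 1#
          ≈⟨ +-congʳ (-‿inverseʳ order) ⟩
        0# - 1#
          ≈⟨ +-identityˡ _ ⟩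
        - 1# ∎

    -- Translating y reduces the sum to the correlation at the difference of the two elements. Its
    -- values, q - 1 at zero and -1 elsewhere, are folded into one expression so that later sums can
    -- be split linearly.
    correlation-value : ∀ i j →
      ∑F (λ y → ⟪ y F.+ F.element i , y F.+ F.element j ⟫) ≈ δ i j * order - 1#
    correlation-value i j = begin
      ∑F (λ y → ⟪ y F.+ x , y F.+ z ⟫)
        ≈⟨ ∑F-cong (λ y → ⟪⟫-congˡ (y F.+ z) (shift y)) ⟩
      ∑F (λ y → ⟪ (y F.+ z) F.+ (x F.- z) , y F.+ z ⟫)
        ≈⟨ ∑F-shift (λ y → ⟪ y F.+ (x F.- z) , y ⟫) (λ e → ⟪⟫-cong (F.+-congʳ e) e) z ⟩
      correlation (x F.- z)
        ≈⟨ value ⟩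
      δ i j * order - 1# ∎
      where
      x = F.element i
      z = F.element j
      shift : ∀ y → y F.+ x F.≈ (y F.+ z) F.+ (x F.- z)
      shift y = F.trans (F.+-congˡ (F.trans (F.sym (cancel--+ F x z)) (F.+-comm (x F.- z) z)))
        (F.sym (F.+-assoc y z (x F.- z)))
      value : correlation (x F.- z) ≈ δ i j * order - 1#
      value with i Fin.≟ j
      ... | yes ≡.refl = begin
        correlation (x F.- x)   ≈⟨ trans (correlation-cong (F.-‿inverseʳ x)) correlation-0 ⟩
        total-norm              ≈⟨ solve 2 (λ t e → t := (t :+ e) :- e) refl total-norm 1# ⟩
        total-norm + 1# - 1#    ≈⟨ +-congʳ T+1≈order ⟩
        order - 1#              ≈⟨ +-congʳ (*-identityˡ order) ⟨
        1# * order - 1#         ∎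
      ... | no i≢j = begin
        correlation (x F.- z)   ≈⟨ correlation-const (x F.- z) x-z≉0 ⟩
        correlation F.1#        ≈⟨ C≈-1 ⟩
        - 1#                    ≈⟨ +-identityˡ (- 1#) ⟨
        0# - 1#                 ≈⟨ +-congʳ (zeroˡ order) ⟨
        0# * order - 1#         ∎
        where
        x-z≉0 : ¬ (x F.- z F.≈ F.0#)
        x-z≉0 x-z≈0 = i≢j (≡.trans (≡.sym (index-element F i)) (≡.trans
          (index-cong F (F.trans (F.sym (cancel--+ F x z)) (F.trans (F.+-congʳ x-z≈0) (F.+-identityˡ z))))
          (index-element F j)))

    -- Second moment of weighted translates, and centring

    translates : (F.Carrier → Carrier) → (Fin q → Carrier) → F.Carrier → Carrier
    translates φ w x = sum (λ b → w b * φ (x F.+ F.element b))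

    ∑-translates : ∀ φ → (∀ {x y} → x F.≈ y → φ x ≈ φ y) → ∑F φ ≈ 0# → ∀ w → ∑F (translates φ w) ≈ 0#
    ∑-translates φ φ-cong ∑φ≈0 w = begin
      ∑F (λ x → sum (λ b → w b * φ (x F.+ F.element b)))
        ≈⟨ ∑-comm (λ i b → w b * φ (F.element i F.+ F.element b)) ⟩
      sum (λ b → ∑F (λ x → w b * φ (x F.+ F.element b)))
        ≈⟨ sum-zero (λ b → trans (sym (*-distribˡ-sum (w b) (λ i → φ (F.element i F.+ F.element b))))
             (trans (*-congˡ (trans (∑F-shift φ φ-cong (F.element b)) ∑φ≈0)) (zeroʳ (w b)))) ⟩
      0# ∎

    -- Expanding the squares leaves a double sum of weights times correlations. The delta part keeps
    -- only the diagonal and yields the sum of squares; the -1 part yields the square of the sum.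
    second-moment : ∀ w →
      ∑F (λ x → translates u w x * translates u w x + translates v w x * translates v w x)
        ≈ order * sum (λ b → w b * w b) - sum w * sum w
    second-moment w = begin
      ∑F (λ x → translates u w x * translates u w x + translates v w x * translates v w x)
        ≈⟨ ∑F-cong expand ⟩
      ∑F (λ x → sum (λ b → sum (λ b′ → term x b b′)))
        ≈⟨ ∑-comm (λ i b → sum (λ b′ → term (F.element i) b b′)) ⟩
      sum (λ b → ∑F (λ x → sum (λ b′ → term x b b′)))
        ≈⟨ sum-cong-≋ (λ b → ∑-comm (λ i b′ → term (F.element i) b b′)) ⟩
      sum (λ b → sum (λ b′ → ∑F (λ x → term x b b′)))
        ≈⟨ sum-cong-≋ (λ b → sum-cong-≋ (λ b′ → evaluate b b′)) ⟩
      sum (λ b → sum (λ b′ → δ b′ b * (w b * w b′ * order) + - w b * w b′))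
        ≈⟨ sum-cong-≋ (λ b → trans (∑-distrib-+ (λ b′ → δ b′ b * (w b * w b′ * order)) (λ b′ → - w b * w b′))
             (+-congʳ (sum-δ (λ b′ → w b * w b′ * order) b))) ⟩
      sum (λ b → w b * w b * order + sum (λ b′ → - w b * w b′))
        ≈⟨ ∑-distrib-+ (λ b → w b * w b * order) (λ b → sum (λ b′ → - w b * w b′)) ⟩
      sum (λ b → w b * w b * order) + sum (λ b → sum (λ b′ → - w b * w b′))
        ≈⟨ +-cong (sym (*-distribʳ-sum order (λ b → w b * w b))) (sym (sum-*-sum (λ b → - w b) w)) ⟩
      sum (λ b → w b * w b) * order + sum (λ b → - w b) * sum w
        ≈⟨ +-cong (*-comm _ order) (trans (*-congʳ sum-neg) (sym (-‿distribˡ-* (sum w) (sum w)))) ⟩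
      order * sum (λ b → w b * w b) - sum w * sum w ∎
      where
      open import Algebra.Properties.Ring ring using (-‿distribˡ-*; -1*x≈-x)
      term : F.Carrier → Fin q → Fin q → Carrier
      term x b b′ = w b * w b′ * ⟪ x F.+ F.element b , x F.+ F.element b′ ⟫
      sum-neg : sum (λ b → - w b) ≈ - sum w
      sum-neg = trans (sum-cong-≋ (λ b → sym (-1*x≈-x (w b)))) (trans (sym (*-distribˡ-sum (- 1#) w)) (-1*x≈-x (sum w)))
      expand : ∀ x → translates u w x * translates u w x + translates v w x * translates v w x
        ≈ sum (λ b → sum (λ b′ → term x b b′))
      expand x = begin
        translates u w x * translates u w x + translates v w x * translates v w x
          ≈⟨ +-cong (sum-*-sum (λ b → w b * u (x F.+ F.element b)) (λ b → w b * u (x F.+ F.element b)))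
                    (sum-*-sum (λ b → w b * v (x F.+ F.element b)) (λ b → w b * v (x F.+ F.element b))) ⟩
        sum (λ b → sum (λ b′ → p b b′)) + sum (λ b → sum (λ b′ → s b b′))
          ≈⟨ ∑-distrib-+ (λ b → sum (p b)) (λ b → sum (s b)) ⟨
        sum (λ b → sum (p b) + sum (s b))
          ≈⟨ sum-cong-≋ (λ b → ∑-distrib-+ (p b) (s b)) ⟨
        sum (λ b → sum (λ b′ → p b b′ + s b b′))
          ≈⟨ sum-cong-≋ (λ b → sum-cong-≋ (λ b′ →
               solve 6 (λ w z a b c d → w :* a :* (z :* c) :+ w :* b :* (z :* d) := w :* z :* (a :* c :+ b :* d)) refl
                 (w b) (w b′) (u (x F.+ F.element b)) (v (x F.+ F.element b))
                 (u (x F.+ F.element b′)) (v (x F.+ F.element b′)))) ⟩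
        sum (λ b → sum (λ b′ → term x b b′)) ∎
        where
        p s : Fin q → Fin q → Carrier
        p b b′ = w b * u (x F.+ F.element b) * (w b′ * u (x F.+ F.element b′))
        s b b′ = w b * v (x F.+ F.element b) * (w b′ * v (x F.+ F.element b′))
      -- `sum-δ` collapses the first index of `δ`, and the inner sum runs over `b′`, so `b′` has to
      -- be moved to the front.
      δ-sym : ∀ (i j : Fin q) → δ i j ≈ δ j i
      δ-sym i j with i Fin.≟ j
      ... | yes i≡j = sym (δ-same (≡.sym i≡j))
      ... | no  i≢j = sym (δ-different (i≢j ∘ ≡.sym))
      evaluate : ∀ b b′ → ∑F (λ x → term x b b′) ≈ δ b′ b * (w b * w b′ * order) + - w b * w b′
      evaluate b b′ = begin
        ∑F (λ x → term x b b′)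
          ≈⟨ *-distribˡ-sum (w b * w b′) (λ i → ⟪ F.element i F.+ F.element b , F.element i F.+ F.element b′ ⟫) ⟨
        w b * w b′ * ∑F (λ x → ⟪ x F.+ F.element b , x F.+ F.element b′ ⟫)
          ≈⟨ *-congˡ (trans (correlation-value b b′) (+-congʳ (*-congʳ (δ-sym b b′)))) ⟩
        w b * w b′ * (δ b′ b * order - 1#)
          ≈⟨ solve 5 (λ w z d o e → w :* z :* (d :* o :- e) := d :* (w :* z :* o) :+ (:- w :* z) :* e)
               refl (w b) (w b′) (δ b′ b) order 1# ⟩
        δ b′ b * (w b * w b′ * order) + (- w b * w b′) * 1#
          ≈⟨ +-congˡ (*-identityʳ _) ⟩
        δ b′ b * (w b * w b′ * order) + - w b * w b′ ∎

    centred : ∀ {n} (w h : Fin n → Carrier) α → sum h ≈ 0# →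
      sum (λ i → w i * h i) ≈ sum (λ i → (w i - α) * h i)
    centred w h α ∑h≈0 = sym (begin
      sum (λ i → (w i - α) * h i)
        ≈⟨ sum-cong-≋ (λ i → solve 3 (λ w α h → (w :- α) :* h := w :* h :+ (:- α) :* h) refl (w i) α (h i)) ⟩
      sum (λ i → w i * h i + - α * h i)
        ≈⟨ ∑-distrib-+ (λ i → w i * h i) (λ i → - α * h i) ⟩
      sum (λ i → w i * h i) + sum (λ i → - α * h i)
        ≈⟨ +-congˡ (trans (sym (*-distribˡ-sum (- α) h)) (trans (*-congˡ ∑h≈0) (zeroʳ (- α)))) ⟩
      sum (λ i → w i * h i) + 0#
        ≈⟨ +-identityʳ _ ⟩
      sum (λ i → w i * h i) ∎)

    -- Idempotence replaces w² by w, and `mean` states α = ∑w / q without division. It turns α² q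
    -- into α ∑w, which cancels one of the two copies of -α ∑w.
    variance : ∀ (w : Fin q → Carrier) α → (∀ i → w i * w i ≈ w i) → order * α ≈ sum w →
      sum (λ i → (w i - α) * (w i - α)) ≈ sum w - α * sum w
    variance w α idem mean = begin
      sum (λ i → (w i - α) * (w i - α))
        ≈⟨ sum-cong-≋ (λ i → trans
             (solve 2 (λ w α → (w :- α) :* (w :- α) := (w :* w :+ (:- (α :+ α)) :* w) :+ α :* α) refl (w i) α)
             (+-cong (+-congʳ (idem i)) (sym (*-identityʳ (α * α))))) ⟩
      sum (λ i → (w i + - (α + α) * w i) + α * α * 1#)
        ≈⟨ trans (∑-distrib-+ (λ i → w i + - (α + α) * w i) (λ _ → α * α * 1#))
             (+-congʳ (∑-distrib-+ w (λ i → - (α + α) * w i))) ⟩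
      sum w + sum (λ i → - (α + α) * w i) + sum {q} (λ _ → α * α * 1#)
        ≈⟨ +-cong (+-congˡ (*-distribˡ-sum (- (α + α)) w)) (*-distribˡ-sum {q} (α * α) (λ _ → 1#)) ⟨
      sum w + - (α + α) * sum w + α * α * order
        ≈⟨ +-congˡ (trans (solve 2 (λ α o → α :* α :* o := α :* (o :* α)) refl α order) (*-congˡ mean)) ⟩
      sum w + - (α + α) * sum w + α * sum w
        ≈⟨ solve 2 (λ s α → s :+ (:- (α :+ α)) :* s :+ α :* s := s :- α :* s) refl (sum w) α ⟩
      sum w - α * sum w ∎

    module Bilinear (s t : Fin q → Carrier) (α : Carrier) where

      -- With `s` and `t` the indicators of A and B, these `P` and `Q` are the real and imaginary
      -- parts of the complex sum ∑_{b ∈ B} χ(a + b).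
      f P Q : Fin q → Carrier
      f a = s a - α
      P a = translates u t (F.element a)
      Q a = translates v t (F.element a)

      real-part : sum (λ a → s a * P a) ≈ sum (λ a → f a * P a)
      real-part = centred s P α (∑-translates u u-cong ∑u≈0 t)

      imaginary-part : sum (λ a → s a * Q a) ≈ sum (λ a → f a * Q a)
      imaginary-part = centred s Q α (∑-translates v v-cong ∑v≈0 t)

      cauchy-schwarz-bound : (∀ i → s i * s i ≈ s i) → (∀ i → t i * t i ≈ t i) → order * α ≈ sum s →
        sum (λ a → f a * f a) * sum (λ a → P a * P a) + sum (λ a → f a * f a) * sum (λ a → Q a * Q a)
          ≈ (sum s - α * sum s) * (order * sum t - sum t * sum t)
      cauchy-schwarz-bound s-idem t-idem mean = begin
        sum (λ a → f a * f a) * sum (λ a → P a * P a) + sum (λ a → f a * f a) * sum (λ a → Q a * Q a)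
          ≈⟨ distribˡ _ _ _ ⟨
        sum (λ a → f a * f a) * (sum (λ a → P a * P a) + sum (λ a → Q a * Q a))
          ≈⟨ *-cong (variance s α s-idem mean) (sym (∑-distrib-+ (λ a → P a * P a) (λ a → Q a * Q a))) ⟩
        (sum s - α * sum s) * sum (λ a → P a * P a + Q a * Q a)
          ≈⟨ *-congˡ (trans (second-moment t) (+-congʳ (*-congˡ (sum-cong-≋ t-idem)))) ⟩
        (sum s - α * sum s) * (order * sum t - sum t * sum t) ∎

-- The real numbers

open ≡ using (refl; sym; trans; cong; cong₂; subst; subst₂)
open import Data.Integer.Base as ℤ using (+_)
open import Data.Rational.Base using (_/_)
open +-*-Solver using (solve; _:=_; _:+_; _:*_; _:-_; :-_; con)

0≤p*p : ∀ p → 0ℚ ℚ.≤ p ℚ.* p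
0≤p*p p with ℚ.≤-total 0ℚ p
... | inj₁ 0≤p = subst (ℚ._≤ p ℚ.* p) (ℚ.*-zeroʳ p) (ℚ.*-monoˡ-≤-nonNeg p {{ℚ.nonNegative 0≤p}} 0≤p)
... | inj₂ p≤0 = subst (ℚ._≤ p ℚ.* p) (ℚ.*-zeroʳ p) (ℚ.*-monoˡ-≤-nonPos p {{ℚ.nonPositive p≤0}} p≤0)

0≤p*q : ∀ {p q} → 0ℚ ℚ.≤ p → 0ℚ ℚ.≤ q → 0ℚ ℚ.≤ p ℚ.* q
0≤p*q {p} {q} 0≤p 0≤q = subst (ℚ._≤ p ℚ.* q) (ℚ.*-zeroʳ p) (ℚ.*-monoˡ-≤-nonNeg p {{ℚ.nonNegative 0≤p}} 0≤q)

0<p*q : ∀ {p q} → 0ℚ ℚ.< p → 0ℚ ℚ.< q → 0ℚ ℚ.< p ℚ.* q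
0<p*q {p} {q} 0<p 0<q = subst (ℚ._< p ℚ.* q) (ℚ.*-zeroʳ p) (ℚ.*-monoʳ-<-pos p {{ℚ.positive 0<p}} 0<q)

p*p≤q*q⇒p≤q : ∀ {p q} → 0ℚ ℚ.≤ q → p ℚ.* p ℚ.≤ q ℚ.* q → p ℚ.≤ q
p*p≤q*q⇒p≤q {p} {q} 0≤q p²≤q² = ℚ.≮⇒≥ λ q<p → ℚ.<-irrefl refl (ℚ.<-≤-trans
  (ℚ.≤-<-trans (ℚ.*-monoˡ-≤-nonNeg q {{ℚ.nonNegative 0≤q}} (ℚ.<⇒≤ q<p))
    (ℚ.*-monoˡ-<-pos p {{ℚ.positive (ℚ.≤-<-trans 0≤q q<p)}} q<p))
  p²≤q²)

p+r≡q⇒p≤q : ∀ {p q} r → 0ℚ ℚ.≤ r → p ℚ.+ r ≡ q → p ℚ.≤ q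
p+r≡q⇒p≤q {p} r 0≤r refl = subst (ℚ._≤ p ℚ.+ r) (ℚ.+-identityʳ p) (ℚ.+-monoʳ-≤ p 0≤r)

0≤q-p : ∀ {p q} → p ℚ.≤ q → 0ℚ ℚ.≤ q ℚ.- p
0≤q-p {p} {q} p≤q = subst (ℚ._≤ q ℚ.- p) (ℚ.+-inverseʳ p) (ℚ.+-monoˡ-≤ (ℚ.- p) p≤q)

∣p∣*∣p∣≡p*p : ∀ p → ℚ.∣ p ∣ ℚ.* ℚ.∣ p ∣ ≡ p ℚ.* p
∣p∣*∣p∣≡p*p p = trans (sym (ℚ.∣p*q∣≡∣p∣*∣q∣ p p)) (ℚ.0≤p⇒∣p∣≡p (0≤p*p p))

p≤∣p∣ : ∀ p → p ℚ.≤ ℚ.∣ p ∣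
p≤∣p∣ p = p*p≤q*q⇒p≤q (ℚ.0≤∣p∣ p) (ℚ.≤-reflexive (sym (∣p∣*∣p∣≡p*p p)))

p*p≤q*q⇒∣p∣≤q : ∀ {p q} → 0ℚ ℚ.≤ q → p ℚ.* p ℚ.≤ q ℚ.* q → ℚ.∣ p ∣ ℚ.≤ q
p*p≤q*q⇒∣p∣≤q {p} {q} 0≤q h = p*p≤q*q⇒p≤q 0≤q (subst (ℚ._≤ q ℚ.* q) (sym (∣p∣*∣p∣≡p*p p)) h)

∣-∣-triangle : ∀ p q r → ℚ.∣ p ℚ.- r ∣ ℚ.≤ ℚ.∣ p ℚ.- q ∣ ℚ.+ ℚ.∣ q ℚ.- r ∣
∣-∣-triangle p q r = subst (λ d → ℚ.∣ d ∣ ℚ.≤ ℚ.∣ p ℚ.- q ∣ ℚ.+ ℚ.∣ q ℚ.- r ∣)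
  (solve 3 (λ p q r → (p :- q) :+ (q :- r) := p :- r) refl p q r)
  (ℚ.∣p+q∣≤∣p∣+∣q∣ (p ℚ.- q) (q ℚ.- r))

∣p-q∣≡∣q-p∣ : ∀ p q → ℚ.∣ p ℚ.- q ∣ ≡ ℚ.∣ q ℚ.- p ∣
∣p-q∣≡∣q-p∣ p q = trans (sym (ℚ.∣-p∣≡∣p∣ (p ℚ.- q)))
  (cong ℚ.∣_∣ (solve 2 (λ p q → :- (p :- q) := q :- p) refl p q))

∣p∣≤∣q∣+∣p-q∣ : ∀ p q → ℚ.∣ p ∣ ℚ.≤ ℚ.∣ q ∣ ℚ.+ ℚ.∣ p ℚ.- q ∣
∣p∣≤∣q∣+∣p-q∣ p q = subst (λ d → ℚ.∣ d ∣ ℚ.≤ ℚ.∣ q ∣ ℚ.+ ℚ.∣ p ℚ.- q ∣)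
  (solve 2 (λ p q → q :+ (p :- q) := p) refl p q) (ℚ.∣p+q∣≤∣p∣+∣q∣ q (p ℚ.- q))

0<½ε : ∀ {ε} → 0ℚ ℚ.< ε → 0ℚ ℚ.< ½ ℚ.* ε
0<½ε = 0<p*q {½} (ℚ.positive⁻¹ ½)

½ε+½ε≡ε : ∀ ε → ½ ℚ.* ε ℚ.+ ½ ℚ.* ε ≡ ε
½ε+½ε≡ε ε = trans (sym (ℚ.*-distribʳ-+ ε ½ ½)) (ℚ.*-identityˡ ε)

divide : ∀ M ε → 0ℚ ℚ.< M → 0ℚ ℚ.< ε → ∃[ δ ] (0ℚ ℚ.< δ × M ℚ.* δ ≡ ε)
divide M ε 0<M 0<ε = 1/M ℚ.* ε , 0<p*q (ℚ.positive⁻¹ 1/M {{ℚ.1/pos⇒pos M {{ℚ.positive 0<M}}}}) 0<ε ,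
  trans (sym (ℚ.*-assoc M 1/M ε))
    (trans (cong (ℚ._* ε) (ℚ.*-inverseʳ M {{ℚ.pos⇒nonZero M {{ℚ.positive 0<M}}}})) (ℚ.*-identityˡ ε))
  where
  1/M : ℚ
  1/M = ℚ.1/_ M {{ℚ.pos⇒nonZero M {{ℚ.positive 0<M}}}}

-- Equality of reals and its compatibility with the operations

Eventually : (ℕ → Set) → Set
Eventually P = ∃[ N ] (∀ n → N ℕ.≤ n → P n)

eventually-map : ∀ {P Q : ℕ → Set} → (∀ n → P n → Q n) → Eventually P → Eventually Q
eventually-map f (N , h) = N , λ n N≤n → f n (h n N≤n)

eventually-map₂ : ∀ {P Q R : ℕ → Set} → (∀ n → P n → Q n → R n) → Eventually P → Eventually Q → Eventually R
eventually-map₂ f (M , g) (N , h) = M ℕ.⊔ N , λ n M⊔N≤n →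
  f n (g n (ℕ.≤-trans (ℕ.m≤m⊔n M N) M⊔N≤n)) (h n (ℕ.≤-trans (ℕ.m≤n⊔m M N) M⊔N≤n))

≈-pointwise : ∀ x y → (∀ n → seq x n ≡ seq y n) → x ≈ᴿ y
≈-pointwise x y eq ε 0<ε = 0 , λ n _ → subst (ℚ._≤ ε)
  (sym (trans (cong (λ p → ℚ.∣ p ℚ.- seq y n ∣) (eq n)) (cong ℚ.∣_∣ (ℚ.+-inverseʳ (seq y n)))))
  (ℚ.<⇒≤ 0<ε)

≈-refl : ∀ x → x ≈ᴿ x
≈-refl x = ≈-pointwise x x (λ _ → refl)

≈-sym : ∀ x y → x ≈ᴿ y → y ≈ᴿ x
≈-sym x y x≈y ε 0<ε = eventually-map (λ n → subst (ℚ._≤ ε) (∣p-q∣≡∣q-p∣ (seq x n) (seq y n))) (x≈y ε 0<ε)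

≈-trans : ∀ x y z → x ≈ᴿ y → y ≈ᴿ z → x ≈ᴿ z
≈-trans x y z x≈y y≈z ε 0<ε = eventually-map₂
  (λ n p r → ℚ.≤-trans (∣-∣-triangle (seq x n) (seq y n) (seq z n))
    (subst (_ ℚ.≤_) (½ε+½ε≡ε ε) (ℚ.+-mono-≤ p r)))
  (x≈y (½ ℚ.* ε) (0<½ε 0<ε)) (y≈z (½ ℚ.* ε) (0<½ε 0<ε))

+ᴿ-cong : ∀ x x′ y y′ → x ≈ᴿ x′ → y ≈ᴿ y′ → x +ᴿ y ≈ᴿ x′ +ᴿ y′
+ᴿ-cong x x′ y y′ x≈ y≈ ε 0<ε = eventually-map₂
  (λ n p r → subst₂ ℚ._≤_
    (cong ℚ.∣_∣ (solve 4 (λ a b c d → (a :- b) :+ (c :- d) := (a :+ c) :- (b :+ d)) refl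
      (seq x n) (seq x′ n) (seq y n) (seq y′ n)))
    (½ε+½ε≡ε ε)
    (ℚ.≤-trans (ℚ.∣p+q∣≤∣p∣+∣q∣ (seq x n ℚ.- seq x′ n) (seq y n ℚ.- seq y′ n)) (ℚ.+-mono-≤ p r)))
  (x≈ (½ ℚ.* ε) (0<½ε 0<ε)) (y≈ (½ ℚ.* ε) (0<½ε 0<ε))

-ᴿ-cong : ∀ x y → x ≈ᴿ y → -ᴿ x ≈ᴿ -ᴿ y
-ᴿ-cong x y x≈y ε 0<ε = eventually-map
  (λ n → subst (ℚ._≤ ε) (trans (∣p-q∣≡∣q-p∣ (seq x n) (seq y n))
    (cong ℚ.∣_∣ (solve 2 (λ a b → b :- a := (:- a) :- (:- b)) refl (seq x n) (seq y n)))))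
  (x≈y ε 0<ε)

eventually-bounded : ∀ x → ∃[ M ] (0ℚ ℚ.< M × Eventually (λ n → ℚ.∣ seq x n ∣ ℚ.≤ M))
eventually-bounded x with cauchy x 1ℚ (ℚ.positive⁻¹ 1ℚ)
... | N , h = ℚ.∣ seq x N ∣ ℚ.+ 1ℚ , ℚ.+-mono-≤-< {0ℚ} {ℚ.∣ seq x N ∣} (ℚ.0≤∣p∣ (seq x N)) (ℚ.positive⁻¹ 1ℚ) ,
  N , λ n N≤n → ℚ.≤-trans (∣p∣≤∣q∣+∣p-q∣ (seq x n) (seq x N))
    (ℚ.+-monoʳ-≤ ℚ.∣ seq x N ∣ (h n N N≤n ℕ.≤-refl))

-- Since |x| is eventually at most some M, accuracy ε / M in the other factor suffices.
-- Commutativity then gives congruence in both factors.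
*ᴿ-congˡ : ∀ x y y′ → y ≈ᴿ y′ → x *ᴿ y ≈ᴿ x *ᴿ y′
*ᴿ-congˡ x y y′ y≈ ε 0<ε =
  let M , 0<M , x≤M = eventually-bounded x
      δ , 0<δ , Mδ≡ε = divide M ε 0<M 0<ε
  in eventually-map₂
    (λ n ∣x∣≤M ∣y-y′∣≤δ → subst₂ ℚ._≤_
      (trans (sym (ℚ.∣p*q∣≡∣p∣*∣q∣ (seq x n) (seq y n ℚ.- seq y′ n)))
        (cong ℚ.∣_∣ (solve 3 (λ a b c → a :* (b :- c) := a :* b :- a :* c) refl (seq x n) (seq y n) (seq y′ n))))
      Mδ≡ε
      (ℚ.≤-trans (ℚ.*-monoˡ-≤-nonNeg ℚ.∣ seq x n ∣ {{ℚ.∣-∣-nonNeg (seq x n)}} ∣y-y′∣≤δ)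
        (ℚ.*-monoʳ-≤-nonNeg δ {{ℚ.nonNegative (ℚ.<⇒≤ 0<δ)}} ∣x∣≤M)))
    x≤M (y≈ δ 0<δ)

*ᴿ-comm : ∀ x y → x *ᴿ y ≈ᴿ y *ᴿ x
*ᴿ-comm x y = ≈-pointwise (x *ᴿ y) (y *ᴿ x) (λ n → ℚ.*-comm (seq x n) (seq y n))

*ᴿ-cong : ∀ x x′ y y′ → x ≈ᴿ x′ → y ≈ᴿ y′ → x *ᴿ y ≈ᴿ x′ *ᴿ y′
*ᴿ-cong x x′ y y′ x≈ y≈ = ≈-trans (x *ᴿ y) (x *ᴿ y′) (x′ *ᴿ y′) (*ᴿ-congˡ x y y′ y≈)
  (≈-trans (x *ᴿ y′) (y′ *ᴿ x) (x′ *ᴿ y′) (*ᴿ-comm x y′)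
    (≈-trans (y′ *ᴿ x) (y′ *ᴿ x′) (x′ *ᴿ y′) (*ᴿ-congˡ y′ x x′ x≈) (*ᴿ-comm y′ x′)))

infix  8 ⊖_
infixl 7 _⊗_
infixl 6 _⊕_

-- Opaque copies of the ring operations: otherwise comparing two reals
-- unfolds the proofs that their sequences are Cauchy.
opaque
  _⊕_ _⊗_ : ℝ → ℝ → ℝ
  _⊕_ = _+ᴿ_
  _⊗_ = _*ᴿ_

  ⊖_ : ℝ → ℝ
  ⊖_ = -ᴿ_

  𝟘 𝟙 : ℝ
  𝟘 = 0ᴿ
  𝟙 = 1ᴿ

  seq-⊕ : ∀ x y n → seq (x ⊕ y) n ≡ seq x n ℚ.+ seq y n
  seq-⊕ x y n = refl

  seq-⊗ : ∀ x y n → seq (x ⊗ y) n ≡ seq x n ℚ.* seq y n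
  seq-⊗ x y n = refl

  seq-𝟘 : ∀ n → seq 𝟘 n ≡ 0ℚ
  seq-𝟘 n = refl

  seq-𝟙 : ∀ n → seq 𝟙 n ≡ 1ℚ
  seq-𝟙 n = refl

  ⊗-cong : ∀ x x′ y y′ → x ≈ᴿ x′ → y ≈ᴿ y′ → x ⊗ y ≈ᴿ x′ ⊗ y′
  ⊗-cong = *ᴿ-cong

  isCommutativeRing : IsCommutativeRing _≈ᴿ_ _⊕_ _⊗_ ⊖_ 𝟘 𝟙
  isCommutativeRing = record
    { isRing = record
      { +-isAbelianGroup = record
        { isGroup = record
          { isMonoid = record
            { isSemigroup = record
              { isMagma = record
                { isEquivalence = record
                  { refl = λ {x} → ≈-refl x
                  ; sym = λ {x y} → ≈-sym x y
                  ; trans = λ {x y z} → ≈-trans x y z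
                  }
                ; ∙-cong = λ {x x′ y y′} → +ᴿ-cong x x′ y y′
                }
              ; assoc = λ x y z → ≈-pointwise (x +ᴿ y +ᴿ z) (x +ᴿ (y +ᴿ z))
                  (λ n → ℚ.+-assoc (seq x n) (seq y n) (seq z n))
              }
            ; identity = (λ x → ≈-pointwise (0ᴿ +ᴿ x) x (λ n → ℚ.+-identityˡ (seq x n)))
                       , (λ x → ≈-pointwise (x +ᴿ 0ᴿ) x (λ n → ℚ.+-identityʳ (seq x n)))
            }
          ; inverse = (λ x → ≈-pointwise (-ᴿ x +ᴿ x) 0ᴿ (λ n → ℚ.+-inverseˡ (seq x n)))
                    , (λ x → ≈-pointwise (x +ᴿ -ᴿ x) 0ᴿ (λ n → ℚ.+-inverseʳ (seq x n)))
          ; ⁻¹-cong = λ {x y} → -ᴿ-cong x y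
          }
        ; comm = λ x y → ≈-pointwise (x +ᴿ y) (y +ᴿ x) (λ n → ℚ.+-comm (seq x n) (seq y n))
        }
      ; *-cong = λ {x x′ y y′} → *ᴿ-cong x x′ y y′
      ; *-assoc = λ x y z → ≈-pointwise (x *ᴿ y *ᴿ z) (x *ᴿ (y *ᴿ z))
          (λ n → ℚ.*-assoc (seq x n) (seq y n) (seq z n))
      ; *-identity = (λ x → ≈-pointwise (1ᴿ *ᴿ x) x (λ n → ℚ.*-identityˡ (seq x n)))
                   , (λ x → ≈-pointwise (x *ᴿ 1ᴿ) x (λ n → ℚ.*-identityʳ (seq x n)))
      ; distrib = (λ x y z → ≈-pointwise (x *ᴿ (y +ᴿ z)) (x *ᴿ y +ᴿ x *ᴿ z)
                    (λ n → ℚ.*-distribˡ-+ (seq x n) (seq y n) (seq z n)))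
                , (λ x y z → ≈-pointwise ((y +ᴿ z) *ᴿ x) (y *ᴿ x +ᴿ z *ᴿ x)
                    (λ n → ℚ.*-distribʳ-+ (seq x n) (seq y n) (seq z n)))
      }
    ; *-comm = *ᴿ-comm
    }

ℝ-commutativeRing : CommutativeRing 0ℓ 0ℓ
ℝ-commutativeRing = record { isCommutativeRing = isCommutativeRing }

opaque
  unfolding _⊕_

  fromℚ-homomorphism :
    CommutativeRing.rawRing ℚ.+-*-commutativeRing -Raw-AlmostCommutative⟶ fromCommutativeRing ℝ-commutativeRing
  fromℚ-homomorphism = record
    { ⟦_⟧    = fromℚ
    ; +-homo = λ p r → ≈-pointwise (fromℚ (p ℚ.+ r)) (fromℚ p +ᴿ fromℚ r) (λ _ → refl)
    ; *-homo = λ p r → ≈-pointwise (fromℚ (p ℚ.* r)) (fromℚ p *ᴿ fromℚ r) (λ _ → refl)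
    ; -‿homo = λ p → ≈-pointwise (fromℚ (ℚ.- p)) (-ᴿ fromℚ p) (λ _ → refl)
    ; 0-homo = ≈-refl 0ᴿ
    ; 1-homo = ≈-refl 1ᴿ
    }

-- Apartness from zero, stability, and absence of zero divisors

Apart : ℝ → Set
Apart x = ∃[ δ ] (0ℚ ℚ.< δ × Eventually (λ n → δ ℚ.≤ ℚ.∣ seq x n ∣))

private
  ∣p-0∣≡∣p∣ : ∀ p → ℚ.∣ p ℚ.- 0ℚ ∣ ≡ ℚ.∣ p ∣
  ∣p-0∣≡∣p∣ p = cong ℚ.∣_∣ (ℚ.+-identityʳ p)

-- Choose N past which terms differ by at most ε / 2 and compare the rational |x N| with ε / 2. If
-- it is no larger, later terms stay below ε; otherwise the margin |x N| - ε / 2 persists for ever,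
-- which is apartness.
¬apart⇒≈0 : ∀ x → ¬ Apart x → x ≈ᴿ 0ᴿ
¬apart⇒≈0 x ¬apart ε 0<ε with cauchy x (½ ℚ.* ε) (0<½ε 0<ε)
... | N , h with ℚ.∣ seq x N ∣ ℚ.≤? ½ ℚ.* ε
...   | yes small = N , λ n N≤n → subst₂ ℚ._≤_ (sym (∣p-0∣≡∣p∣ (seq x n))) (½ε+½ε≡ε ε)
        (ℚ.≤-trans (∣p∣≤∣q∣+∣p-q∣ (seq x n) (seq x N)) (ℚ.+-mono-≤ small (h n N N≤n ℕ.≤-refl)))
...   | no large = contradiction
        (ℚ.∣ seq x N ∣ ℚ.- δ , subst (ℚ._< ℚ.∣ seq x N ∣ ℚ.- δ) (ℚ.+-inverseʳ δ) (ℚ.+-monoˡ-< (ℚ.- δ) (ℚ.≰⇒> large)) ,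
          N , λ n N≤n → subst (ℚ.∣ seq x N ∣ ℚ.- δ ℚ.≤_)
            (solve 2 (λ a d → (a :+ d) :- d := a) refl ℚ.∣ seq x n ∣ δ)
            (ℚ.+-monoˡ-≤ (ℚ.- δ) (ℚ.≤-trans (∣p∣≤∣q∣+∣p-q∣ (seq x N) (seq x n))
              (ℚ.+-monoʳ-≤ ℚ.∣ seq x n ∣ (h N n ℕ.≤-refl N≤n)))))
        ¬apart
        where δ = ½ ℚ.* ε

apart⇒≉0 : ∀ x → Apart x → ¬ (x ≈ᴿ 0ᴿ)
apart⇒≉0 x (δ , 0<δ , M , far) x≈0 with x≈0 (½ ℚ.* δ) (0<½ε 0<δ)
... | N , near = ℚ.<-irrefl refl (ℚ.<-≤-trans ½δ<δ (ℚ.≤-trans (far (M ℕ.⊔ N) (ℕ.m≤m⊔n M N))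
    (subst (ℚ._≤ ½ ℚ.* δ) (∣p-0∣≡∣p∣ (seq x (M ℕ.⊔ N))) (near (M ℕ.⊔ N) (ℕ.m≤n⊔m M N)))))
  where
  ½δ<δ : ½ ℚ.* δ ℚ.< δ
  ½δ<δ = subst₂ ℚ._<_ (ℚ.+-identityʳ (½ ℚ.* δ)) (½ε+½ε≡ε δ) (ℚ.+-monoʳ-< (½ ℚ.* δ) (0<½ε 0<δ))

-- Being zero is equivalent to the negated statement `¬ Apart x`, and negations are stable.
≈0-stable : ∀ x → ¬ ¬ (x ≈ᴿ 0ᴿ) → x ≈ᴿ 0ᴿ
≈0-stable x ¬¬x≈0 = ¬apart⇒≈0 x (λ apart → ¬¬x≈0 (apart⇒≉0 x apart))

≈-stable : ∀ x y → ¬ ¬ (x ≈ᴿ y) → x ≈ᴿ y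
≈-stable x y ¬¬x≈y = x-y≈0⇒x≈y (≈0-stable (x -ᴿ y) (λ x-y≉0 → ¬¬x≈y (λ x≈y → x-y≉0 (x≈y⇒x-y≈0 x≈y))))
  where
  x-y≈0⇒x≈y : x -ᴿ y ≈ᴿ 0ᴿ → x ≈ᴿ y
  x-y≈0⇒x≈y h ε 0<ε = eventually-map (λ n → subst (ℚ._≤ ε) (∣p-0∣≡∣p∣ (seq x n ℚ.- seq y n))) (h ε 0<ε)
  x≈y⇒x-y≈0 : x ≈ᴿ y → x -ᴿ y ≈ᴿ 0ᴿ
  x≈y⇒x-y≈0 h ε 0<ε = eventually-map (λ n → subst (ℚ._≤ ε) (sym (∣p-0∣≡∣p∣ (seq x n ℚ.- seq y n)))) (h ε 0<ε)

-- A bare `x ≉ 0` provides no margin to divide by. By stability it is enough to refute `y ≉ 0`: a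
-- margin δ for x would give |y| ≤ ε from |xy| ≤ δ ε, so under `y ≉ 0` there is no margin, and x is
-- zero after all.
*ᴿ-integral : ∀ x y → x *ᴿ y ≈ᴿ 0ᴿ → ¬ (x ≈ᴿ 0ᴿ) → y ≈ᴿ 0ᴿ
*ᴿ-integral x y xy≈0 x≉0 = ≈0-stable y (λ y≉0 → x≉0 (¬apart⇒≈0 x (λ apart → y≉0 (quotient apart))))
  where
  quotient : Apart x → y ≈ᴿ 0ᴿ
  quotient (δ , 0<δ , far) ε 0<ε = eventually-map₂
    (λ n δ≤∣x∣ ∣xy∣≤δε → subst (ℚ._≤ ε) (sym (∣p-0∣≡∣p∣ (seq y n)))
      (ℚ.*-cancelˡ-≤-pos δ {{ℚ.positive 0<δ}} (ℚ.≤-trans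
        (ℚ.*-monoʳ-≤-nonNeg ℚ.∣ seq y n ∣ {{ℚ.∣-∣-nonNeg (seq y n)}} δ≤∣x∣)
        (subst (ℚ._≤ δ ℚ.* ε)
          (trans (∣p-0∣≡∣p∣ (seq x n ℚ.* seq y n)) (ℚ.∣p*q∣≡∣p∣*∣q∣ (seq x n) (seq y n)))
          ∣xy∣≤δε))))
    far (xy≈0 (δ ℚ.* ε) (0<p*q 0<δ 0<ε))

opaque
  unfolding _⊕_

  ⊗-integral : ∀ x y → x ⊗ y ≈ᴿ 𝟘 → ¬ (x ≈ᴿ 𝟘) → y ≈ᴿ 𝟘
  ⊗-integral = *ᴿ-integral

  -- The maps from here to the end of the block are identities; they carry statements across the
  -- opaque boundary.
  ≈0⇒≈𝟘 : ∀ x → x ≈ᴿ 0ᴿ → x ≈ᴿ 𝟘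
  ≈0⇒≈𝟘 x x≈0 = x≈0

  ≈𝟘⇒≈0 : ∀ x → x ≈ᴿ 𝟘 → x ≈ᴿ 0ᴿ
  ≈𝟘⇒≈0 x x≈𝟘 = x≈𝟘

  ≈𝟙⇒≈1 : ∀ x → x ≈ᴿ 𝟙 → x ≈ᴿ 1ᴿ
  ≈𝟙⇒≈1 x x≈𝟙 = x≈𝟙

  ⊗⊖⊗-intro : ∀ x a b c d → x ≈ᴿ a *ᴿ b -ᴿ c *ᴿ d → x ≈ᴿ a ⊗ b ⊕ ⊖ (c ⊗ d)
  ⊗⊖⊗-intro x a b c d h = h

  ⊗⊕⊗-intro : ∀ x a b c d → x ≈ᴿ a *ᴿ b +ᴿ c *ᴿ d → x ≈ᴿ a ⊗ b ⊕ c ⊗ d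
  ⊗⊕⊗-intro x a b c d h = h

-- Finite sums of reals, read off index by index

open SemiringSum (CommutativeRing.semiring ℝ-commutativeRing) using (sum; sum-cong-≋)
open SemiringSum (CommutativeRing.semiring ℚ.+-*-commutativeRing) using (sum-cong-≗) renaming (sum to ℚsum)
open RawMonoidDefinitions +ᶜ-rawMonoid using () renaming (sum to ℂsum)

seq-sum : ∀ {m} (t : Fin m → ℝ) n → seq (sum t) n ≡ ℚsum (λ i → seq (t i) n)
seq-sum {zero}  t n = seq-𝟘 n
seq-sum {suc m} t n = trans (seq-⊕ (t zero) (sum (λ i → t (suc i))) n)
  (cong (seq (t zero) n ℚ.+_) (seq-sum (λ i → t (suc i)) n))

sum-nonNeg : ∀ {m} (t : Fin m → ℚ) → (∀ i → 0ℚ ℚ.≤ t i) → 0ℚ ℚ.≤ ℚsum t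
sum-nonNeg {zero}  t 0≤t = ℚ.≤-refl
sum-nonNeg {suc m} t 0≤t = ℚ.+-mono-≤ {0ℚ} (0≤t zero) (sum-nonNeg (λ i → t (suc i)) (λ i → 0≤t (suc i)))

term≤sum : ∀ {m} (t : Fin m → ℚ) → (∀ i → 0ℚ ℚ.≤ t i) → ∀ i → t i ℚ.≤ ℚsum t
term≤sum t 0≤t zero = p+r≡q⇒p≤q _ (sum-nonNeg (λ i → t (suc i)) (λ i → 0≤t (suc i))) refl
term≤sum t 0≤t (suc i) = ℚ.≤-trans (term≤sum (λ i → t (suc i)) (λ i → 0≤t (suc i)) i)
  (p+r≡q⇒p≤q _ (0≤t zero) (ℚ.+-comm _ (t zero)))

-- At each index a single square is at most the whole sum, so accuracy ε² for the sum gives accuracy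
-- ε for every entry.
sum-squares-definite : ∀ {m} (f g : Fin m → ℝ) →
  sum (λ i → f i ⊗ f i ⊕ g i ⊗ g i) ≈ᴿ 𝟘 → ∀ i → (f i ≈ᴿ 𝟘) × (g i ≈ᴿ 𝟘)
sum-squares-definite {m} f g h i =
  ≈0⇒≈𝟘 (f i) (λ ε 0<ε → eventually-map (λ n → bound n (seq (f i) n) ε 0<ε
    (p+r≡q⇒p≤q _ (0≤p*p (seq (g i) n)) refl)) (h (ε ℚ.* ε) (0<p*q 0<ε 0<ε))) ,
  ≈0⇒≈𝟘 (g i) (λ ε 0<ε → eventually-map (λ n → bound n (seq (g i) n) ε 0<ε
    (p+r≡q⇒p≤q _ (0≤p*p (seq (f i) n)) (ℚ.+-comm _ (seq (f i) n ℚ.* seq (f i) n)))) (h (ε ℚ.* ε) (0<p*q 0<ε 0<ε)))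
  where
  t : Fin m → ℝ
  t j = f j ⊗ f j ⊕ g j ⊗ g j
  squares : ℕ → Fin m → ℚ
  squares n j = seq (f j) n ℚ.* seq (f j) n ℚ.+ seq (g j) n ℚ.* seq (g j) n
  seq-t : ∀ n j → seq (t j) n ≡ squares n j
  seq-t n j = trans (seq-⊕ (f j ⊗ f j) (g j ⊗ g j) n) (cong₂ ℚ._+_ (seq-⊗ (f j) (f j) n) (seq-⊗ (g j) (g j) n))
  difference : ∀ n → seq (sum t) n ℚ.- seq 𝟘 n ≡ ℚsum (squares n)
  difference n = trans (cong₂ ℚ._-_ (trans (seq-sum t n) (sum-cong-≗ (seq-t n))) (seq-𝟘 n)) (ℚ.+-identityʳ _)
  bound : ∀ n s ε → 0ℚ ℚ.< ε → s ℚ.* s ℚ.≤ squares n i →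
    ℚ.∣ seq (sum t) n ℚ.- seq 𝟘 n ∣ ℚ.≤ ε ℚ.* ε → ℚ.∣ s ℚ.- 0ℚ ∣ ℚ.≤ ε
  bound n s ε 0<ε s²≤ small = subst (ℚ._≤ ε) (sym (∣p-0∣≡∣p∣ s))
    (p*p≤q*q⇒∣p∣≤q (ℚ.<⇒≤ 0<ε) (ℚ.≤-trans s²≤
      (ℚ.≤-trans (term≤sum (squares n) (λ j → ℚ.+-mono-≤ {0ℚ} (0≤p*p (seq (f j) n)) (0≤p*p (seq (g j) n))) i)
        (ℚ.≤-trans (p≤∣p∣ (ℚsum (squares n))) (subst (λ d → ℚ.∣ d ∣ ℚ.≤ ε ℚ.* ε) (difference n) small)))))

-- Cauchy-Schwarz over ℚ

[p+p]²≤[q+r]² : ∀ p q r → p ℚ.* p ℚ.≤ q ℚ.* r → (p ℚ.+ p) ℚ.* (p ℚ.+ p) ℚ.≤ (q ℚ.+ r) ℚ.* (q ℚ.+ r)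
[p+p]²≤[q+r]² p q r pp≤qr = begin
  (p ℚ.+ p) ℚ.* (p ℚ.+ p)
    ≡⟨ solve 1 (λ p → (p :+ p) :* (p :+ p) := (p :* p :+ p :* p) :+ (p :* p :+ p :* p)) refl p ⟩
  (p ℚ.* p ℚ.+ p ℚ.* p) ℚ.+ (p ℚ.* p ℚ.+ p ℚ.* p)
    ≤⟨ ℚ.+-mono-≤ (ℚ.+-mono-≤ pp≤qr pp≤qr) (ℚ.+-mono-≤ pp≤qr pp≤qr) ⟩
  (q ℚ.* r ℚ.+ q ℚ.* r) ℚ.+ (q ℚ.* r ℚ.+ q ℚ.* r)
    ≤⟨ p+r≡q⇒p≤q _ (0≤p*p (q ℚ.- r))
         (solve 2 (λ q r → ((q :* r :+ q :* r) :+ (q :* r :+ q :* r)) :+ (q :- r) :* (q :- r)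
            := (q :+ r) :* (q :+ r)) refl q r) ⟩
  (q ℚ.+ r) ℚ.* (q ℚ.+ r) ∎
  where open ℚ.≤-Reasoning

-- The cross term satisfies 2abS ≤ a²X + b²F. This is the inequality of arithmetic and geometric
-- means, applied to (abS)² ≤ (a²X)(b²F) and compared after squaring, so that no root of F X is
-- taken.
cauchy-schwarz-step : ∀ a b S F X → 0ℚ ℚ.≤ F → 0ℚ ℚ.≤ X → S ℚ.* S ℚ.≤ F ℚ.* X →
  (a ℚ.* b ℚ.+ S) ℚ.* (a ℚ.* b ℚ.+ S) ℚ.≤ (a ℚ.* a ℚ.+ F) ℚ.* (b ℚ.* b ℚ.+ X)
cauchy-schwarz-step a b S F X 0≤F 0≤X ih = begin
  (a ℚ.* b ℚ.+ S) ℚ.* (a ℚ.* b ℚ.+ S)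
    ≡⟨ solve 2 (λ c S → (c :+ S) :* (c :+ S) := c :* c :+ (c :* S :+ c :* S) :+ S :* S) refl (a ℚ.* b) S ⟩
  a ℚ.* b ℚ.* (a ℚ.* b) ℚ.+ (a ℚ.* b ℚ.* S ℚ.+ a ℚ.* b ℚ.* S) ℚ.+ S ℚ.* S
    ≤⟨ ℚ.+-mono-≤ (ℚ.+-monoʳ-≤ (a ℚ.* b ℚ.* (a ℚ.* b)) cross) ih ⟩
  a ℚ.* b ℚ.* (a ℚ.* b) ℚ.+ (a ℚ.* a ℚ.* X ℚ.+ b ℚ.* b ℚ.* F) ℚ.+ F ℚ.* X
    ≡⟨ solve 4 (λ a b F X → a :* b :* (a :* b) :+ (a :* a :* X :+ b :* b :* F) :+ F :* X
         := (a :* a :+ F) :* (b :* b :+ X)) refl a b F X ⟩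
  (a ℚ.* a ℚ.+ F) ℚ.* (b ℚ.* b ℚ.+ X) ∎
  where
  open ℚ.≤-Reasoning
  cross : a ℚ.* b ℚ.* S ℚ.+ a ℚ.* b ℚ.* S ℚ.≤ a ℚ.* a ℚ.* X ℚ.+ b ℚ.* b ℚ.* F
  cross = p*p≤q*q⇒p≤q
    (ℚ.+-mono-≤ {0ℚ} (0≤p*q (0≤p*p a) 0≤X) (0≤p*q (0≤p*p b) 0≤F))
    ([p+p]²≤[q+r]² (a ℚ.* b ℚ.* S) (a ℚ.* a ℚ.* X) (b ℚ.* b ℚ.* F) (begin
      a ℚ.* b ℚ.* S ℚ.* (a ℚ.* b ℚ.* S)
        ≡⟨ solve 2 (λ c S → c :* S :* (c :* S) := c :* c :* (S :* S)) refl (a ℚ.* b) S ⟩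
      a ℚ.* b ℚ.* (a ℚ.* b) ℚ.* (S ℚ.* S)
        ≤⟨ ℚ.*-monoˡ-≤-nonNeg (a ℚ.* b ℚ.* (a ℚ.* b)) {{ℚ.nonNegative (0≤p*p (a ℚ.* b))}} ih ⟩
      a ℚ.* b ℚ.* (a ℚ.* b) ℚ.* (F ℚ.* X)
        ≡⟨ solve 4 (λ a b F X → a :* b :* (a :* b) :* (F :* X) := a :* a :* X :* (b :* b :* F)) refl a b F X ⟩
      a ℚ.* a ℚ.* X ℚ.* (b ℚ.* b ℚ.* F) ∎))

cauchy-schwarz : ∀ {m} (f x : Fin m → ℚ) →
  ℚsum (λ i → f i ℚ.* x i) ℚ.* ℚsum (λ i → f i ℚ.* x i)
    ℚ.≤ ℚsum (λ i → f i ℚ.* f i) ℚ.* ℚsum (λ i → x i ℚ.* x i)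
cauchy-schwarz {zero} f x = ℚ.≤-refl
cauchy-schwarz {suc m} f x = cauchy-schwarz-step (f zero) (x zero)
  (ℚsum (λ i → f (suc i) ℚ.* x (suc i))) (ℚsum (λ i → f (suc i) ℚ.* f (suc i))) (ℚsum (λ i → x (suc i) ℚ.* x (suc i)))
  (sum-nonNeg (λ i → f (suc i) ℚ.* f (suc i)) (λ i → 0≤p*p (f (suc i))))
  (sum-nonNeg (λ i → x (suc i) ℚ.* x (suc i)) (λ i → 0≤p*p (x (suc i))))
  (cauchy-schwarz (λ i → f (suc i)) (λ i → x (suc i)))

-- Order and square roots of reals

≈⇒≤ : ∀ x y → x ≈ᴿ y → x ≤ᴿ y
≈⇒≤ x y x≈y ε 0<ε = eventually-map (λ n h → subst (ℚ._≤ seq y n ℚ.+ ε)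
    (solve 2 (λ x y → y :+ (x :- y) := x) refl (seq x n) (seq y n))
    (ℚ.+-monoʳ-≤ (seq y n) (ℚ.≤-trans (p≤∣p∣ (seq x n ℚ.- seq y n)) h)))
  (x≈y ε 0<ε)

≤-trans : ∀ x y z → x ≤ᴿ y → y ≤ᴿ z → x ≤ᴿ z
≤-trans x y z x≤y y≤z ε 0<ε = eventually-map₂
  (λ n p r → ℚ.≤-trans p (subst (seq y n ℚ.+ ½ ℚ.* ε ℚ.≤_)
    (trans (ℚ.+-assoc (seq z n) (½ ℚ.* ε) (½ ℚ.* ε)) (cong (seq z n ℚ.+_) (½ε+½ε≡ε ε)))
    (ℚ.+-monoˡ-≤ (½ ℚ.* ε) r)))
  (x≤y (½ ℚ.* ε) (0<½ε 0<ε)) (y≤z (½ ℚ.* ε) (0<½ε 0<ε))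

≤-pointwise : ∀ x y → (∀ n → seq x n ℚ.≤ seq y n) → x ≤ᴿ y
≤-pointwise x y x≤y ε 0<ε = 0 , λ n _ → ℚ.≤-trans (x≤y n) (p+r≡q⇒p≤q ε (ℚ.<⇒≤ 0<ε) refl)

-- Ask for x ≤ y² + ε². As y and ε are nonnegative, this is at most (y + ε)², and each root
-- approximation squares to at most max(0, x).
√-upper-bound : ∀ x y → (∀ n → 0ℚ ℚ.≤ seq y n) → x ≤ᴿ y *ᴿ y → √ x ≤ᴿ y
√-upper-bound x y 0≤y x≤y² ε 0<ε = eventually-map
  (λ n h → p*p≤q*q⇒p≤q (ℚ.+-mono-≤ {0ℚ} (0≤y n) (ℚ.<⇒≤ 0<ε))
    (ℚ.≤-trans (root-approx-lower n (seq x n)) (ℚ.⊔-lub (0≤p*p (seq y n ℚ.+ ε)) (ℚ.≤-trans h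
      (p+r≡q⇒p≤q _ (ℚ.+-mono-≤ {0ℚ} (yε n) (yε n))
        (solve 2 (λ y e → (y :* y :+ e :* e) :+ (y :* e :+ y :* e) := (y :+ e) :* (y :+ e)) refl (seq y n) ε))))))
  (x≤y² (ε ℚ.* ε) (0<p*q 0<ε 0<ε))
  where
  yε : ∀ n → 0ℚ ℚ.≤ seq y n ℚ.* ε
  yε n = 0≤p*q (0≤y n) (ℚ.<⇒≤ 0<ε)

-- With r the approximation and u = 1/(n + 1), r² ≤ p < (r + u)², so the error is below u (2r + u),
-- which tends to zero because r stays bounded.
√-square : ∀ p → 0ℚ ℚ.≤ p → √ (fromℚ p) *ᴿ √ (fromℚ p) ≈ᴿ fromℚ p
√-square p 0≤p ε 0<ε =
  let δ , 0<δ , Mδ≡ε = divide M ε 0<M 0<ε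
  in eventually-map₂ (λ n u≤1 u≤δ → close n u≤1 (subst (+ 1 / suc n ℚ.* M ℚ.≤_) (trans (ℚ.*-comm δ M) Mδ≡ε)
       (ℚ.*-monoʳ-≤-nonNeg M {{ℚ.nonNegative (ℚ.<⇒≤ 0<M)}} u≤δ)))
     (archimedean 1ℚ (ℚ.positive⁻¹ 1ℚ)) (archimedean δ 0<δ)
  where
  M : ℚ
  -- A bound for 2r + u, from r ≤ 1 + p and u ≤ 1.
  M = (1ℚ ℚ.+ p) ℚ.+ (1ℚ ℚ.+ p) ℚ.+ 1ℚ
  0≤1 : 0ℚ ℚ.≤ 1ℚ
  0≤1 = ℚ.nonNegative⁻¹ 1ℚ
  0≤1+p : 0ℚ ℚ.≤ 1ℚ ℚ.+ p
  0≤1+p = ℚ.+-mono-≤ {0ℚ} 0≤1 0≤p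
  0<M : 0ℚ ℚ.< M
  0<M = ℚ.+-mono-≤-< {0ℚ} (ℚ.+-mono-≤ {0ℚ} 0≤1+p 0≤1+p) (ℚ.positive⁻¹ 1ℚ)
  0⊔p≡p : 0ℚ ℚ.⊔ p ≡ p
  0⊔p≡p = ℚ.p≤q⇒p⊔q≡q 0≤p
  module _ (n : ℕ) where
    r u : ℚ
    r = root-approx n p
    u = + 1 / suc n
    0≤u : 0ℚ ℚ.≤ u
    0≤u = ℚ.nonNegative⁻¹ u {{ℚ.normalize-nonNeg 1 (suc n)}}
    r²≤p : r ℚ.* r ℚ.≤ p
    r²≤p = subst (r ℚ.* r ℚ.≤_) 0⊔p≡p (root-approx-lower n p)
    r≤1+p : r ℚ.≤ 1ℚ ℚ.+ p
    r≤1+p = p*p≤q*q⇒p≤q 0≤1+p (ℚ.≤-trans r²≤p (p+r≡q⇒p≤q _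
      (ℚ.+-mono-≤ {0ℚ} 0≤1+p (0≤p*p p))
      (solve 1 (λ p → p :+ ((con 1ℚ :+ p) :+ p :* p) := (con 1ℚ :+ p) :* (con 1ℚ :+ p)) refl p)))
    close : u ℚ.≤ 1ℚ → u ℚ.* M ℚ.≤ ε → ℚ.∣ r ℚ.* r ℚ.- p ∣ ℚ.≤ ε
    close u≤1 uM≤ε = begin
      ℚ.∣ r ℚ.* r ℚ.- p ∣
        ≡⟨ ∣p-q∣≡∣q-p∣ (r ℚ.* r) p ⟩
      ℚ.∣ p ℚ.- r ℚ.* r ∣
        ≡⟨ ℚ.0≤p⇒∣p∣≡p (0≤q-p r²≤p) ⟩
      p ℚ.- r ℚ.* r
        ≤⟨ ℚ.+-monoˡ-≤ (ℚ.- (r ℚ.* r)) (ℚ.<⇒≤ (subst (ℚ._< (r ℚ.+ u) ℚ.* (r ℚ.+ u)) 0⊔p≡p (root-approx-upper n p))) ⟩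
      (r ℚ.+ u) ℚ.* (r ℚ.+ u) ℚ.- r ℚ.* r
        ≡⟨ solve 2 (λ r u → (r :+ u) :* (r :+ u) :- r :* r := u :* (r :+ r :+ u)) refl r u ⟩
      u ℚ.* (r ℚ.+ r ℚ.+ u)
        ≤⟨ ℚ.*-monoˡ-≤-nonNeg u {{ℚ.nonNegative 0≤u}} (ℚ.+-mono-≤ (ℚ.+-mono-≤ r≤1+p r≤1+p) u≤1) ⟩
      u ℚ.* M
        ≤⟨ uM≤ε ⟩
      ε ∎
      where open ℚ.≤-Reasoning

-- The weights `f` are real, so the complex inequality is the sum of two real ones, each exact at
-- every index.
two-cauchy-schwarz : ∀ {m} (f P Q : Fin m → ℝ) →
  sum (λ a → f a ⊗ P a) ⊗ sum (λ a → f a ⊗ P a) ⊕ sum (λ a → f a ⊗ Q a) ⊗ sum (λ a → f a ⊗ Q a)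
    ≤ᴿ sum (λ a → f a ⊗ f a) ⊗ sum (λ a → P a ⊗ P a) ⊕ sum (λ a → f a ⊗ f a) ⊗ sum (λ a → Q a ⊗ Q a)
two-cauchy-schwarz {m} f P Q = ≤-pointwise
  (dot f P ⊗ dot f P ⊕ dot f Q ⊗ dot f Q) (dot f f ⊗ dot P P ⊕ dot f f ⊗ dot Q Q)
  (λ n → subst₂ ℚ._≤_
    (sym (seq-dots n f P f P f Q f Q)) (sym (seq-dots n f f P P f f Q Q))
    (ℚ.+-mono-≤ (cauchy-schwarz (λ i → seq (f i) n) (λ i → seq (P i) n))
                (cauchy-schwarz (λ i → seq (f i) n) (λ i → seq (Q i) n))))
  where
  dot : (X Y : Fin m → ℝ) → ℝ
  dot X Y = sum (λ a → X a ⊗ Y a)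
  ℚdot : ℕ → (X Y : Fin m → ℝ) → ℚ
  ℚdot n X Y = ℚsum (λ a → seq (X a) n ℚ.* seq (Y a) n)
  seq-dot : ∀ n X Y → seq (dot X Y) n ≡ ℚdot n X Y
  seq-dot n X Y = trans (seq-sum (λ a → X a ⊗ Y a) n) (sum-cong-≗ (λ a → seq-⊗ (X a) (Y a) n))
  seq-dots : ∀ n X X′ Y Y′ Z Z′ V V′ → seq (dot X X′ ⊗ dot Y Y′ ⊕ dot Z Z′ ⊗ dot V V′) n
    ≡ ℚdot n X X′ ℚ.* ℚdot n Y Y′ ℚ.+ ℚdot n Z Z′ ℚ.* ℚdot n V V′
  seq-dots n X X′ Y Y′ Z Z′ V V′ = trans (seq-⊕ (dot X X′ ⊗ dot Y Y′) (dot Z Z′ ⊗ dot V V′) n)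
    (cong₂ ℚ._+_
      (trans (seq-⊗ (dot X X′) (dot Y Y′) n) (cong₂ ℚ._*_ (seq-dot n X X′) (seq-dot n Y Y′)))
      (trans (seq-⊗ (dot Z Z′) (dot V V′) n) (cong₂ ℚ._*_ (seq-dot n Z Z′) (seq-dot n V V′))))

-- Sums over subsets

toℚᵘ-/ : ∀ i n → toℚᵘ (i / suc n) ℚᵘ.≃ mkℚᵘ i n
toℚᵘ-/ i n = ℚ.toℚᵘ-fromℚᵘ (mkℚᵘ i n)

suc-/1 : ∀ n → 1ℚ ℚ.+ + n / 1 ≡ + suc n / 1
suc-/1 n = ℚ.toℚᵘ-injective (ℚᵘ.≃-trans (ℚ.toℚᵘ-homo-+ 1ℚ (+ n / 1))
  (ℚᵘ.≃-trans (ℚᵘ.+-congʳ (toℚᵘ 1ℚ) (toℚᵘ-/ (+ n) 0))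
    (ℚᵘ.≃-trans (ℚᵘ.*≡* (cong (λ i → (+ 1 ℤ.+ i) ℤ.* + 1) (ℤ.*-identityʳ (+ n)))) (ℚᵘ.≃-sym (toℚᵘ-/ (+ suc n) 0)))))

*-/1 : ∀ m n → + m / 1 ℚ.* (+ n / 1) ≡ + (m ℕ.* n) / 1
*-/1 m n = ℚ.toℚᵘ-injective (ℚᵘ.≃-trans (ℚ.toℚᵘ-homo-* (+ m / 1) (+ n / 1))
  (ℚᵘ.≃-trans (ℚᵘ.*-cong (toℚᵘ-/ (+ m) 0) (toℚᵘ-/ (+ n) 0))
    (ℚᵘ.≃-trans (ℚᵘ.*≡* (cong (ℤ._* + 1) (sym (ℤ.pos-* m n)))) (ℚᵘ.≃-sym (toℚᵘ-/ (+ (m ℕ.* n)) 0)))))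

n*[k/n]≡k : ∀ k n {{_ : ℕ.NonZero n}} → + n / 1 ℚ.* (+ k / n) ≡ + k / 1
n*[k/n]≡k k (suc n) = ℚ.toℚᵘ-injective (ℚᵘ.≃-trans (ℚ.toℚᵘ-homo-* (+ suc n / 1) (+ k / suc n))
  (ℚᵘ.≃-trans (ℚᵘ.*-cong (toℚᵘ-/ (+ suc n) 0) (toℚᵘ-/ (+ k) n))
    (ℚᵘ.≃-trans (ℚᵘ.*≡* (trans (ℤ.*-identityʳ _) (trans (ℤ.*-comm (+ suc n) (+ k))
      (cong (λ m → + k ℤ.* + m) (sym (ℕ.*-identityˡ (suc n))))))) (ℚᵘ.≃-sym (toℚᵘ-/ (+ k) 0)))))

k≤n⇒k/n≤1 : ∀ k n {{_ : ℕ.NonZero n}} → k ℕ.≤ n → + k / n ℚ.≤ 1ℚ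
k≤n⇒k/n≤1 k (suc n) k≤n = ℚ.toℚᵘ-cancel-≤ (ℚᵘ.≤-respˡ-≃ (ℚᵘ.≃-sym (toℚᵘ-/ (+ k) n))
  (ℚᵘ.*≤* (subst₂ ℤ._≤_ (sym (ℤ.*-identityʳ (+ k))) (sym (ℤ.*-identityˡ (+ suc n))) (ℤ.+≤+ k≤n))))

bit : Bool → ℝ
bit b = if b then 𝟙 else 𝟘

indicator : ∀ {n} → Subset n → Fin n → ℝ
indicator A i = bit (lookup A i)

bit-idempotent : ∀ b → bit b ⊗ bit b ≈ᴿ bit b
bit-idempotent true  = CommutativeRing.*-identityˡ ℝ-commutativeRing 𝟙
bit-idempotent false = CommutativeRing.zeroˡ ℝ-commutativeRing 𝟘

sum-indicator : ∀ {n} (A : Subset n) → sum (indicator A) ≈ᴿ fromℕ ∣ A ∣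
sum-indicator A = ≈-pointwise (sum (indicator A)) (fromℕ ∣ A ∣) (λ k → trans (seq-sum (indicator A) k) (count A k))
  where
  count : ∀ {n} (A : Subset n) k → ℚsum (λ i → seq (indicator A i) k) ≡ + ∣ A ∣ / 1
  count []          k = refl
  count (true  ∷ A) k = trans (cong₂ ℚ._+_ (seq-𝟙 k) (count A k)) (suc-/1 ∣ A ∣)
  count (false ∷ A) k = trans (cong₂ ℚ._+_ (seq-𝟘 k) (count A k)) (ℚ.+-identityˡ (+ ∣ A ∣ / 1))

sum-𝟙 : ∀ n → sum {n} (λ _ → 𝟙) ≈ᴿ fromℕ n
sum-𝟙 n = ≈-pointwise (sum {n} (λ _ → 𝟙)) (fromℕ n) (λ k → trans (seq-sum {n} (λ _ → 𝟙) k) (count n k))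
  where
  count : ∀ n k → ℚsum {n} (λ _ → seq 𝟙 k) ≡ + n / 1
  count zero    k = refl
  count (suc n) k = trans (cong₂ ℚ._+_ (seq-𝟙 k) (count n k)) (suc-/1 n)

re-sum : ∀ {n} (t : Fin n → ℂ) k → seq (re (ℂsum t)) k ≡ ℚsum (λ i → seq (re (t i)) k)
re-sum {zero}  t k = refl
re-sum {suc n} t k = cong (seq (re (t zero)) k ℚ.+_) (re-sum (λ i → t (suc i)) k)

im-sum : ∀ {n} (t : Fin n → ℂ) k → seq (im (ℂsum t)) k ≡ ℚsum (λ i → seq (im (t i)) k)
im-sum {zero}  t k = refl
im-sum {suc n} t k = cong (seq (im (t zero)) k ℚ.+_) (im-sum (λ i → t (suc i)) k)

-- `π` stands for `re` or `im`, so both parts of the double sum are treated at once.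
module _ (π : ℂ → ℝ) (π-0 : ∀ k → seq (π 0ᶜ) k ≡ 0ℚ)
         (π-sum : ∀ {n} (t : Fin n → ℂ) k → seq (π (ℂsum t)) k ≡ ℚsum (λ i → seq (π (t i)) k)) where

  bit-part : ∀ b z k → seq (π (if b then z else 0ᶜ)) k ≡ seq (bit b ⊗ π z) k
  bit-part true  z k = sym (trans (seq-⊗ 𝟙 (π z) k) (trans (cong (ℚ._* seq (π z) k) (seq-𝟙 k)) (ℚ.*-identityˡ (seq (π z) k))))
  bit-part false z k = trans (π-0 k)
    (sym (trans (seq-⊗ 𝟘 (π z) k) (trans (cong (ℚ._* seq (π z) k) (seq-𝟘 k)) (ℚ.*-zeroˡ (seq (π z) k)))))

  ∑-part : ∀ {n} (A : Subset n) (z : Fin n → ℂ) → π (∑ A z) ≈ᴿ sum (λ i → indicator A i ⊗ π (z i))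
  ∑-part A z = ≈-pointwise (π (∑ A z)) (sum (λ i → indicator A i ⊗ π (z i))) (λ k →
    trans (π-sum (λ i → if lookup A i then z i else 0ᶜ) k)
      (trans (sum-cong-≗ (λ i → bit-part (lookup A i) (z i) k))
        (sym (seq-sum (λ i → indicator A i ⊗ π (z i)) k))))

  ∑∑-part : ∀ {m n} (A : Subset m) (B : Subset n) (z : Fin m → Fin n → ℂ) →
    π (∑ A (λ a → ∑ B (z a))) ≈ᴿ sum (λ a → indicator A a ⊗ sum (λ b → indicator B b ⊗ π (z a b)))
  ∑∑-part {m} A B z = ≈-trans (π (∑ A (λ a → ∑ B (z a)))) (sum f) (sum g)
    (∑-part A (λ a → ∑ B (z a)))
    (sum-cong-≋ {x = f} {y = g} (λ a → ⊗-cong (indicator A a) (indicator A a) (π (∑ B (z a))) (sum (λ b → indicator B b ⊗ π (z a b)))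
      (≈-refl (indicator A a)) (∑-part B (z a))))
    where
    f g : Fin m → ℝ
    f a = indicator A a ⊗ π (∑ B (z a))
    g a = indicator A a ⊗ sum (λ b → indicator B b ⊗ π (z a b))

-- Substituting b = q β turns q b - b² into q b (1 - β), the form in which the density of B appears
-- in the bound.
moment-product-identity : ∀ q a b α β → q ℚ.* β ≡ b →
  (a ℚ.- α ℚ.* a) ℚ.* (q ℚ.* b ℚ.- b ℚ.* b) ≡ q ℚ.* a ℚ.* b ℚ.* (1ℚ ℚ.- α) ℚ.* (1ℚ ℚ.- β)
moment-product-identity q a .(q ℚ.* β) α β refl = solve 4 (λ q a α β →
  (a :- α :* a) :* (q :* (q :* β) :- q :* β :* (q :* β))
    := q :* a :* (q :* β) :* (con 1ℚ :- α) :* (con 1ℚ :- β)) refl q a α β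

opaque
  unfolding _⊕_

  seq-moment-product : ∀ a α q b n → seq ((a ⊕ ⊖ (α ⊗ a)) ⊗ (q ⊗ b ⊕ ⊖ (b ⊗ b))) n
    ≡ (seq a n ℚ.- seq α n ℚ.* seq a n) ℚ.* (seq q n ℚ.* seq b n ℚ.- seq b n ℚ.* seq b n)
  seq-moment-product a α q b n = refl

-- The bound for a fixed character and pair of sets

module CharacterBound {f₁ f₂ : Level} {q : ℕ} (F : FiniteField f₁ f₂ q) (χ : MultiplicativeCharacter F)
    (nontrivial : ¬ MultiplicativeCharacter.Trivial χ) (A B : Subset q) where
  open FiniteField F using (element; density; q-nonZero; _+_; 0#; _≈_; _*_; Carrier)
  open MultiplicativeCharacter χ using (⟦_⟧; ⟦⟧-cong; nonzero; homo; at-0)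
  open CommutativeRing ℝ-commutativeRing using (*-cong; +-cong; -‿cong; *-congˡ)

  u v : Carrier → ℝ
  u x = re ⟦ x ⟧
  v x = im ⟦ x ⟧

  u-cong : ∀ {x y} → x ≈ y → u x ≈ᴿ u y
  u-cong x≈y = proj₁ (⟦⟧-cong x≈y)

  v-cong : ∀ {x y} → x ≈ y → v x ≈ᴿ v y
  v-cong x≈y = proj₂ (⟦⟧-cong x≈y)

  uv-nonzero : ∀ x → ¬ (x ≈ 0#) → ¬ ((u x ≈ᴿ 𝟘) × (v x ≈ᴿ 𝟘))
  uv-nonzero x x≉0 (u≈𝟘 , v≈𝟘) = nonzero x x≉0 (≈𝟘⇒≈0 (u x) u≈𝟘 , ≈𝟘⇒≈0 (v x) v≈𝟘)

  u-homo : ∀ x y → ¬ (x ≈ 0#) → ¬ (y ≈ 0#) → u (x * y) ≈ᴿ u x ⊗ u y ⊕ ⊖ (v x ⊗ v y)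
  u-homo x y x≉0 y≉0 = ⊗⊖⊗-intro (u (x * y)) (u x) (u y) (v x) (v y) (proj₁ (homo x y x≉0 y≉0))

  v-homo : ∀ x y → ¬ (x ≈ 0#) → ¬ (y ≈ 0#) → v (x * y) ≈ᴿ u x ⊗ v y ⊕ v x ⊗ u y
  v-homo x y x≉0 y≉0 = ⊗⊕⊗-intro (v (x * y)) (u x) (v y) (v x) (u y) (proj₂ (homo x y x≉0 y≉0))

  uv-nontrivial : ¬ (∀ x → ¬ (x ≈ 0#) → (u x ≈ᴿ 𝟙) × (v x ≈ᴿ 𝟘))
  uv-nontrivial trivial = nontrivial λ x x≉0 →
    ≈𝟙⇒≈1 (u x) (proj₁ (trivial x x≉0)) , ≈𝟘⇒≈0 (v x) (proj₂ (trivial x x≉0))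

  open CharacterSums ℝ-commutativeRing fromℚ-homomorphism F
  open Character ≈-stable ⊗-integral sum-squares-definite u v u-cong v-cong uv-nonzero u-homo v-homo
    (≈0⇒≈𝟘 (u 0#) (proj₁ at-0)) (≈0⇒≈𝟘 (v 0#) (proj₂ at-0)) uv-nontrivial
    using (order; module Bilinear)

  α β : ℚ
  α = density A
  β = density B

  open Bilinear (indicator A) (indicator B) (fromℚ α)

  S : ℂ
  S = ∑[ a ∈ A ] ∑[ b ∈ B ] ⟦ element a + element b ⟧

  q/1 A/1 B/1 : ℚ
  q/1 = + q / 1
  A/1 = + ∣ A ∣ / 1
  B/1 = + ∣ B ∣ / 1

  -- The proof is the chain N ≈ X ≤ Z ≈ W ≈ y²: |S|², the same with centred weights, its
  -- Cauchy-Schwarz bound, the value of that bound, and the square of the claimed right-hand side.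
  c a b y N X Z W : ℝ
  c = √ (fromℕ (q ℕ.* ∣ A ∣ ℕ.* ∣ B ∣))
  a = √ (fromℚ (1ℚ ℚ.- α))
  b = √ (fromℚ (1ℚ ℚ.- β))
  y = c *ᴿ a *ᴿ b
  N = re S *ᴿ re S +ᴿ im S *ᴿ im S
  X = sum (λ i → f i ⊗ P i) ⊗ sum (λ i → f i ⊗ P i) ⊕ sum (λ i → f i ⊗ Q i) ⊗ sum (λ i → f i ⊗ Q i)
  Z = sum (λ i → f i ⊗ f i) ⊗ sum (λ i → P i ⊗ P i) ⊕ sum (λ i → f i ⊗ f i) ⊗ sum (λ i → Q i ⊗ Q i)
  W = fromℕ (q ℕ.* ∣ A ∣ ℕ.* ∣ B ∣) *ᴿ fromℚ (1ℚ ℚ.- α) *ᴿ fromℚ (1ℚ ℚ.- β)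

  re≈ : re S ≈ᴿ sum (λ i → f i ⊗ P i)
  re≈ = ≈-trans (re S) (sum (λ i → indicator A i ⊗ P i)) (sum (λ i → f i ⊗ P i))
    (∑∑-part re (λ _ → refl) re-sum A B (λ a b → ⟦ element a + element b ⟧)) real-part

  im≈ : im S ≈ᴿ sum (λ i → f i ⊗ Q i)
  im≈ = ≈-trans (im S) (sum (λ i → indicator A i ⊗ Q i)) (sum (λ i → f i ⊗ Q i))
    (∑∑-part im (λ _ → refl) im-sum A B (λ a b → ⟦ element a + element b ⟧)) imaginary-part

  N≈X : N ≈ᴿ X
  N≈X = ≈-trans N (re S ⊗ re S ⊕ im S ⊗ im S) X
    (⊗⊕⊗-intro N (re S) (re S) (im S) (im S) (≈-refl N))
    (+-cong (*-cong re≈ re≈) (*-cong im≈ im≈))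

  sA sB W₁ W₂ : ℝ
  sA = sum (indicator A)
  sB = sum (indicator B)
  W₁ = (sA ⊕ ⊖ (fromℚ α ⊗ sA)) ⊗ (order ⊗ sB ⊕ ⊖ (sB ⊗ sB))
  W₂ = (fromℚ A/1 ⊕ ⊖ (fromℚ α ⊗ fromℚ A/1)) ⊗ (fromℚ q/1 ⊗ fromℚ B/1 ⊕ ⊖ (fromℚ B/1 ⊗ fromℚ B/1))

  order*α≈sA : order ⊗ fromℚ α ≈ᴿ sA
  order*α≈sA = ≈-trans (order ⊗ fromℚ α) (fromℚ q/1 ⊗ fromℚ α) sA
    (⊗-cong order (fromℚ q/1) (fromℚ α) (fromℚ α) (sum-𝟙 q) (≈-refl (fromℚ α)))
    (≈-trans (fromℚ q/1 ⊗ fromℚ α) (fromℚ A/1) sA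
      (≈-pointwise (fromℚ q/1 ⊗ fromℚ α) (fromℚ A/1)
        (λ n → trans (seq-⊗ (fromℚ q/1) (fromℚ α) n) (n*[k/n]≡k ∣ A ∣ q {{q-nonZero}})))
      (≈-sym sA (fromℚ A/1) (sum-indicator A)))

  W₁≈W₂ : W₁ ≈ᴿ W₂
  W₁≈W₂ = *-cong (+-cong sA≈ (-‿cong (*-congˡ sA≈))) (+-cong (*-cong (sum-𝟙 q) sB≈) (-‿cong (*-cong sB≈ sB≈)))
    where
    sA≈ : sA ≈ᴿ fromℚ A/1
    sA≈ = sum-indicator A
    sB≈ : sB ≈ᴿ fromℚ B/1
    sB≈ = sum-indicator B

  W₂≈W : W₂ ≈ᴿ W
  W₂≈W = ≈-pointwise W₂ W (λ n → trans (seq-moment-product (fromℚ A/1) (fromℚ α) (fromℚ q/1) (fromℚ B/1) n) (trans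
    (moment-product-identity q/1 A/1 B/1 α β (n*[k/n]≡k ∣ B ∣ q {{q-nonZero}}))
    (cong (λ x → x ℚ.* (1ℚ ℚ.- α) ℚ.* (1ℚ ℚ.- β))
      (trans (cong (ℚ._* B/1) (*-/1 q ∣ A ∣)) (*-/1 (q ℕ.* ∣ A ∣) ∣ B ∣)))))

  Z≈W : Z ≈ᴿ W
  Z≈W = ≈-trans Z W₁ W
    (cauchy-schwarz-bound (λ i → bit-idempotent (lookup A i)) (λ i → bit-idempotent (lookup B i)) order*α≈sA)
    (≈-trans W₁ W₂ W W₁≈W₂ W₂≈W)

  y²≈W : y *ᴿ y ≈ᴿ W
  y²≈W = ≈-trans (y *ᴿ y) (c *ᴿ c *ᴿ (a *ᴿ a) *ᴿ (b *ᴿ b)) W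
    (≈-pointwise (y *ᴿ y) (c *ᴿ c *ᴿ (a *ᴿ a) *ᴿ (b *ᴿ b)) (λ n →
      solve 3 (λ c a b → c :* a :* b :* (c :* a :* b) := c :* c :* (a :* a) :* (b :* b)) refl (seq c n) (seq a n) (seq b n)))
    (*ᴿ-cong (c *ᴿ c *ᴿ (a *ᴿ a)) (fromℕ (q ℕ.* ∣ A ∣ ℕ.* ∣ B ∣) *ᴿ fromℚ (1ℚ ℚ.- α)) (b *ᴿ b) (fromℚ (1ℚ ℚ.- β))
      (*ᴿ-cong (c *ᴿ c) (fromℕ (q ℕ.* ∣ A ∣ ℕ.* ∣ B ∣)) (a *ᴿ a) (fromℚ (1ℚ ℚ.- α))
        (√-square (+ (q ℕ.* ∣ A ∣ ℕ.* ∣ B ∣) / 1) (ℚ.nonNegative⁻¹ _ {{ℚ.normalize-nonNeg (q ℕ.* ∣ A ∣ ℕ.* ∣ B ∣) 1}}))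
        (√-square (1ℚ ℚ.- α) (0≤q-p (k≤n⇒k/n≤1 ∣ A ∣ q {{q-nonZero}} (∣p∣≤n A)))))
      (√-square (1ℚ ℚ.- β) (0≤q-p (k≤n⇒k/n≤1 ∣ B ∣ q {{q-nonZero}} (∣p∣≤n B)))))

  bound : ∣ S ∣ᶜ ≤ᴿ y
  bound = √-upper-bound N y
    -- Every approximant of `y` is a product of three root approximations, hence nonnegative, as the
    -- comparison of squares requires.
    (λ n → 0≤p*q {seq c n ℚ.* seq a n} {seq b n}
      (0≤p*q {seq c n} {seq a n} (0≤root-approx n (+ (q ℕ.* ∣ A ∣ ℕ.* ∣ B ∣) / 1)) (0≤root-approx n (1ℚ ℚ.- α)))
      (0≤root-approx n (1ℚ ℚ.- β)))
    (≤-trans N X (y *ᴿ y) (≈⇒≤ N X N≈X) (≤-trans X Z (y *ᴿ y) (two-cauchy-schwarz f P Q)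
      (≈⇒≤ Z (y *ᴿ y) (≈-trans Z W (y *ᴿ y) Z≈W (≈-sym (y *ᴿ y) W y²≈W)))))

theorem1p14 : {c ℓ : Level} (p k q : ℕ) → Prime p → ¬ (2 ∣ p) → 1 ℕ.≤ k → q ≡ p ℕ.^ k →
    (F : FiniteField c ℓ q) (χ : MultiplicativeCharacter F) →
    let open FiniteField F
        open MultiplicativeCharacter χ
    in
    ¬ Trivial → (A B : Subset q) →
    ∣ ∑[ a ∈ A ] ∑[ b ∈ B ] ⟦ element a + element b ⟧ ∣ᶜ
      ≤ᴿ √ (fromℕ (q ℕ.* ∣ A ∣ ℕ.* ∣ B ∣)) *ᴿ √ (fromℚ (1ℚ ℚ.- density A)) *ᴿ √ (fromℚ (1ℚ ℚ.- density B))
theorem1p14 p k q _ _ _ _ F χ nontrivial A B = CharacterBound.bound F χ nontrivial A B
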